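{- Let $P$ be a polymatroid on $[n]$ with rank function $f$, and fix $t\in[n]$. Put $\alpha_t=f([n])-f([n]\setminus\{t\})$, $\beta_t=f(\{t\})$, $T_t=\{\alpha_t,\alpha_t+1,\ldots,\beta_t\}$, and for $j\in T_t$ let $\widehat P^t_j=\{(a_1,\ldots,a_{t-1},a_{t+1},\ldots,a_n)\mid (a_1,\ldots,a_n)\in P,\ a_t=j\}$, a polymatroid on $[n]\setminus\{t\}$. If $\beta_t-\alpha_t>0$, then $$\mathscr{T}_P(x,y)=x\,\mathscr{T}_{\widehat P^t_{\alpha_t}}(x,y)+y\,\mathscr{T}_{\widehat P^t_{\beta_t}}(x,y)+\sum_{j\in T_t\setminus\{\alpha_t,\beta_t\}}\mathscr{T}_{\widehat P^t_j}(x,y).$$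
   Context: For a finite totally ordered set $S$ (here subsets of $[n]$ with the natural order), a polymatroid on $S$ is a set $P=\{\mathbf a\in\mathbb{Z}^S\mid \sum_{i\in I}a_i\le f(I)\ \forall I\subset S,\ \sum_{i\in S}a_i=f(S)\}$ where $f:2^S\to\mathbb{Z}$ has $f(\emptyset)=0$ and is submodular; $f$ is its rank function, $f(I)=\max_{\mathbf a\in P}\sum_{i\in I}a_i$. Let $\mathbf e_i$ denote unit vectors. For $\mathbf a\in P$, $i\in S$ is internally active if $\mathbf a-\mathbf e_i+\mathbf e_j\notin P$ for all $j\in S$ with $j<i$, and externally active if $\mathbf a+\mathbf e_i-\mathbf e_j\notin P$ for all $j\in S$ with $j<i$; let $\mathrm{Int}(\mathbf a)$, $\mathrm{Ext}(\mathbf a)$ be the sets of such indices. The polymatroid Tutte polynomial is $\mathscr{T}_P(x,y)=\sum_{\mathbf a\in P}x^{|\mathrm{Int}(\mathbf a)\setminus\mathrm{Ext}(\mathbf a)|}y^{|\mathrm{Ext}(\mathbf a)\setminus\mathrm{Int}(\mathbf a)|}(x+y-1)^{|\mathrm{Int}(\mathbf a)\cap\mathrm{Ext}(\mathbf a)|}$. -}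

module Defs where

open import Data.Bool using (Bool; true; false; _∧_; not; if_then_else_)
open import Data.Nat as ℕ using (ℕ; zero; suc)
open import Data.Integer as ℤ using (ℤ; +_; -[1+_]; 0ℤ; 1ℤ; ∣_∣; _≤ᵇ_; _≤_)
open import Data.Integer.Properties using () renaming (_≟_ to _≟ℤ_)
open import Data.Fin using (Fin; zero; suc; punchIn; punchOut)
open import Data.Fin.Properties using () renaming (_≟_ to _≟F_; _<?_ to _<?F_)
open import Data.Fin.Subset using (Subset; _∪_; _∩_; ⊤; ⁅_⁆; inside; outside)
open import Data.Vec using (Vec; []; _∷_; lookup)
open import Data.List using (List; []; _∷_; map; concatMap; filterᵇ; foldr; allFin; upTo; length)
open import Data.Bool.ListAction using (all)
open import Relation.Nullary using (yes; no)
open import Relation.Nullary.Decidable using (⌊_⌋)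
import Algebra.Bundles
open Algebra.Bundles using (CommutativeRing)
open import Function using (_∘_)

Vect : ℕ → Set
Vect n = Fin n → ℤ

sumVec : ∀ {n} → Vect n → ℤ
sumVec {zero}  a = 0ℤ
sumVec {suc n} a = a zero ℤ.+ sumVec (a ∘ suc)

sumOn : ∀ {n} → Subset n → Vect n → ℤ
sumOn I a = sumVec (λ i → if lookup I i then a i else 0ℤ)

e : ∀ {n} → Fin n → Vect n
e i k = if ⌊ k ≟F i ⌋ then 1ℤ else 0ℤ

moveOut : ∀ {n} → Vect n → Fin n → Fin n → Vect n
moveOut a i j k = a k ℤ.- e i k ℤ.+ e j k

moveIn : ∀ {n} → Vect n → Fin n → Fin n → Vect n
moveIn a i j k = a k ℤ.+ e i k ℤ.- e j k

allSubsets : ∀ n → List (Subset n)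
allSubsets zero    = [] ∷ []
allSubsets (suc n) = concatMap (λ s → (inside ∷ s) ∷ (outside ∷ s) ∷ []) (allSubsets n)

Submodular : ∀ {n} → (Subset n → ℤ) → Set
Submodular {n} f = ∀ (A B : Subset n) → f (A ∪ B) ℤ.+ f (A ∩ B) ≤ f A ℤ.+ f B

inPolymatroid : ∀ {n} → (Subset n → ℤ) → Vect n → Bool
inPolymatroid {n} f a =
  all (λ I → sumOn I a ≤ᵇ f I) (allSubsets n) ∧ ⌊ sumVec a ≟ℤ f ⊤ ⌋

allVecs : ∀ n → List ℤ → List (Vect n)
allVecs zero    xs = (λ ()) ∷ []
allVecs (suc n) xs =
  concatMap (λ x → map (λ v → λ { zero → x ; (suc k) → v k }) (allVecs n xs)) xs

sumℕ : ∀ {n} → (Fin n → ℕ) → ℕ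
sumℕ {zero}  g = 0
sumℕ {suc n} g = g zero ℕ.+ sumℕ (g ∘ suc)

-- a bound B such that every a ∈ P has all coordinates in [-B, B]
-- (a_i ≤ f({i}) and a_i = f([n]) - Σ_{j≠i} a_j ≥ f([n]) - Σ_{j≠i} f({j}))
bound : ∀ {n} → (Subset n → ℤ) → ℕ
bound f = ∣ f ⊤ ∣ ℕ.+ sumℕ (λ i → ∣ f ⁅ i ⁆ ∣)

polymatroidElems : ∀ {n} → (Subset n → ℤ) → List (Vect n)
polymatroidElems {n} f =
  filterᵇ (inPolymatroid f)
    (allVecs n (map (λ k → + k ℤ.- + (bound f)) (upTo (suc (2 ℕ.* bound f)))))

-- The polymatroid Tutte polynomial of a finite set of integer vectors
-- (given by its membership test and an enumeration of its elements),
-- evaluated at x, y in an arbitrary commutative ring.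

module Tutte {c ℓ} (R : CommutativeRing c ℓ) where
  open CommutativeRing R
  open import Algebra.Definitions.RawSemiring (Algebra.Bundles.Semiring.rawSemiring semiring) using (_^_)

  internallyActive : ∀ {n} → (Vect n → Bool) → Vect n → Fin n → Bool
  internallyActive {n} mem a i =
    all (λ j → if ⌊ j <?F i ⌋ then not (mem (moveOut a i j)) else true)
        (allFin n)

  externallyActive : ∀ {n} → (Vect n → Bool) → Vect n → Fin n → Bool
  externallyActive {n} mem a i =
    all (λ j → if ⌊ j <?F i ⌋ then not (mem (moveIn a i j)) else true)
        (allFin n)

  count : ∀ {n} → (Fin n → Bool) → ℕ
  count {n} p = length (filterᵇ p (allFin n))

  weight : ∀ {n} → (Vect n → Bool) → Carrier → Carrier → Vect n → Carrier
  weight mem x y a =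
    (x ^ count (λ i → internallyActive mem a i ∧ not (externallyActive mem a i)))
    * (y ^ count (λ i → externallyActive mem a i ∧ not (internallyActive mem a i)))
    * ((x + y + (- 1#)) ^ count (λ i → internallyActive mem a i ∧ externallyActive mem a i))

  tutte : ∀ {n} → (Vect n → Bool) → List (Vect n) → Carrier → Carrier → Carrier
  tutte mem elems x y = foldr (λ a s → weight mem x y a + s) 0# elems

  tutteP : ∀ {n} → (Subset n → ℤ) → Carrier → Carrier → Carrier
  tutteP f = tutte (inPolymatroid f) (polymatroidElems f)

  sumList : List Carrier → Carrier
  sumList = foldr _+_ 0#

-- Restriction  \hat P^t_j  on [n] \ {t}, with n = suc m.  The ground set
-- [n] \ {t} (with its natural order) is identified with Fin m via the
-- order-preserving bijection  punchIn t : Fin m → Fin (suc m) \ {t}.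

insertAt : ∀ {m} → Fin (suc m) → ℤ → Vect m → Vect (suc m)
insertAt t j b k with t ≟F k
... | yes _  = j
... | no t≢k = b (punchOut t≢k)

inSlice : ∀ {m} → (Subset (suc m) → ℤ) → Fin (suc m) → ℤ → Vect m → Bool
inSlice f t j b = inPolymatroid f (insertAt t j b)

sliceElems : ∀ {m} → (Subset (suc m) → ℤ) → Fin (suc m) → ℤ → List (Vect m)
sliceElems f t j =
  map (λ a → a ∘ punchIn t) (filterᵇ (λ a → ⌊ a t ≟ℤ j ⌋) (polymatroidElems f))

αₜ : ∀ {n} → (Subset n → ℤ) → Fin n → ℤ
αₜ f t = f ⊤ ℤ.- f (Data.Fin.Subset.∁ ⁅ t ⁆)

βₜ : ∀ {n} → (Subset n → ℤ) → Fin n → ℤ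
βₜ f t = f ⁅ t ⁆

-- the integer interval {lo, lo+1, …, hi} (empty if hi < lo)
natPart : ℤ → ℕ
natPart (+ k)    = k
natPart -[1+ _ ] = 0

intervalℤ : ℤ → ℤ → List ℤ
intervalℤ lo hi = map (λ k → lo ℤ.+ + k) (upTo (natPart (hi ℤ.- lo ℤ.+ 1ℤ)))

module TutteSlice {c ℓ} (R : CommutativeRing c ℓ) where
  open Tutte R
  open CommutativeRing R using (Carrier)

  tutteSlice : ∀ {m} → (Subset (suc m) → ℤ) → Fin (suc m) → ℤ → Carrier → Carrier → Carrier
  tutteSlice f t j = tutte (inSlice f t j) (sliceElems f t j)

{-# OPTIONS --safe #-}
module Submission where

-- For the last element t = n the recursion is immediate: by the exchange
-- property, n is internally (externally) active in a exactly when a_n is minimal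
-- (maximal) on P, and the activity of every other element is computed inside the
-- slice. For another t, slice by n and then, inductively, by t; by the known case
-- this must agree with slicing by t and then by n. Both are weighted sums of
-- U(p,q) = T(P ∩ {a_n = p, a_t = q}) over the projection Q ⊆ ℤ² of P. The two
-- weights of a point differ only on the two extreme diagonals p + q = const of
-- the hexagon Q, by a difference that telescopes along the direction (1,-1); as U
-- is constant on each extreme diagonal, the weighted sums agree.
-- The induction runs over bounded sets with the exchange property, because these
-- are closed under slicing; the polymatroid of f is one since tight sets are
-- closed under union and intersection.

open import Defs
open import Data.Bool as Bool using (Bool; true; false; _∧_; _∨_; not; if_then_else_)
open import Data.Bool.ListAction using (all; any)
import Data.Bool.Properties as Boolₚ
open import Data.Bool.Properties using (T-≡; ¬-not; not-¬; not-injective; ⇔→≡)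
open import Data.Nat as ℕ using (ℕ; zero; suc)
import Data.Nat.Properties as ℕₚ
open import Data.Integer as ℤ using (ℤ; 0ℤ; 1ℤ; _<_; _≤_; +_; ∣_∣)
import Data.Integer.Properties as ℤₚ
open import Data.Integer.Tactic.RingSolver using (solve-∀)
open import Data.Fin as Fin using (Fin; zero; suc; punchIn; punchOut; fromℕ; inject₁)
import Data.Fin.Properties as Finₚ
open import Data.Fin.Relation.Unary.Top using (view; ‵fromℕ; ‵inj₁)
open import Data.Fin.Subset using (Subset; _∪_; _∩_; ⊤; ⊥; ⁅_⁆; ∁)
open import Data.Vec using ([]; _∷_; lookup)
import Data.Vec.Properties as Vecₚ
open import Data.List as List
  using (List; []; _∷_; _++_; map; concatMap; filterᵇ; foldr; allFin; tabulate; upTo; length)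
import Data.List.Properties as Listₚ
open import Data.List.Membership.Propositional using (_∈_; lose)
open import Data.List.Membership.Propositional.Properties using (∈-allFin; ∈-concatMap⁺; ∈-map⁺)
open import Data.List.Relation.Unary.Any using (here; there)
open import Data.Product using (∃; _×_; _,_; proj₁; proj₂)
open import Data.Sum as Sum using (_⊎_; inj₁; inj₂)
open import Algebra.Bundles using (CommutativeRing)
open import Function using (_∘_; mk⇔; Equivalence)
open import Relation.Nullary using (Dec; yes; no; ¬_; ¬?; contradiction)
open import Relation.Nullary.Decidable using (⌊_⌋; _×-dec_)
open import Relation.Binary.PropositionalEquality as ≡ using (_≡_; _≢_; _≗_; cong; cong₂; subst; subst₂)

-- For t ≠ n a term-by-term comparison with the slices by t fails: when i > t, the index t may
-- itself be the exchange partner that keeps i from being active, and such a move leaves the slice.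
-- So the weight of a point need not be a factor for t times its weight in the slice; only the sums
-- agree. In effect the induction shows that t may be treated as if it came last in the order. The
-- constant x + y - 1 is what makes the comparison of the two orders of slicing work. It equals 1 +
-- (x - 1) + (y - 1), so the coefficient of a slice is affine in the two indicators "no value just
-- below" and "no value just above". Near a point of Q, membership of its six neighbours is all that
-- enters the two weights, and their comparison reduces to finitely many polynomial identities.

iff⇒≡ : ∀ {b c} → (b ≡ true → c ≡ true) → (c ≡ true → b ≡ true) → b ≡ c
iff⇒≡ f g = ⇔→≡ (mk⇔ f g)

⌊≟⌋-refl : ∀ {n} (i : Fin n) → ⌊ i Finₚ.≟ i ⌋ ≡ true
⌊≟⌋-refl i with i Finₚ.≟ i
... | yes _ = ≡.refl
... | no i≢i = contradiction ≡.refl i≢i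

⌊≟⌋-≢ : ∀ {n} {i j : Fin n} → i ≢ j → ⌊ i Finₚ.≟ j ⌋ ≡ false
⌊≟⌋-≢ {i = i} {j} i≢j with i Finₚ.≟ j
... | yes i≡j = contradiction i≡j i≢j
... | no _ = ≡.refl

-- Unit moves and insertion of a coordinate.

e-self : ∀ {n} (i : Fin n) → e i i ≡ 1ℤ
e-self i = cong (if_then 1ℤ else 0ℤ) (⌊≟⌋-refl i)

e-other : ∀ {n} {i k : Fin n} → k ≢ i → e i k ≡ 0ℤ
e-other k≢i = cong (if_then 1ℤ else 0ℤ) (⌊≟⌋-≢ k≢i)

e-punchIn : ∀ {n} (t : Fin (suc n)) i k → e (punchIn t i) (punchIn t k) ≡ e i k
e-punchIn t i k with k Finₚ.≟ i
... | yes ≡.refl = e-self (punchIn t k)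
... | no k≢i = e-other (k≢i ∘ Finₚ.punchIn-injective t k i)

private
  a-1+0 : ∀ a → a ℤ.- 1ℤ ℤ.+ 0ℤ ≡ a ℤ.- 1ℤ
  a-1+0 = solve-∀

  a-0+1 : ∀ a → a ℤ.- 0ℤ ℤ.+ 1ℤ ≡ a ℤ.+ 1ℤ
  a-0+1 = solve-∀

  a-0+0 : ∀ a → a ℤ.- 0ℤ ℤ.+ 0ℤ ≡ a
  a-0+0 = solve-∀

module _ {n} (a : Vect n) where

  moveOut-source : ∀ {i j} → i ≢ j → moveOut a i j i ≡ a i ℤ.- 1ℤ
  moveOut-source {i} i≢j rewrite e-self i | e-other i≢j = a-1+0 (a i)

  moveOut-target : ∀ {i j} → i ≢ j → moveOut a i j j ≡ a j ℤ.+ 1ℤ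
  moveOut-target {i} {j} i≢j rewrite e-self j | e-other (i≢j ∘ ≡.sym) = a-0+1 (a j)

  moveOut-other : ∀ {i j k} → k ≢ i → k ≢ j → moveOut a i j k ≡ a k
  moveOut-other {k = k} k≢i k≢j rewrite e-other k≢i | e-other k≢j = a-0+0 (a k)

  moveIn≗moveOut : ∀ i j → moveIn a i j ≗ moveOut a j i
  moveIn≗moveOut i j k = lemma (a k) (e i k) (e j k)
    where
    lemma : ∀ x y z → x ℤ.+ y ℤ.- z ≡ x ℤ.- z ℤ.+ y
    lemma = solve-∀

data Position {n} (t : Fin (suc n)) : Fin (suc n) → Set where
  hit  : Position t t
  miss : ∀ k → Position t (punchIn t k)

position : ∀ {n} (t k : Fin (suc n)) → Position t k
position t k with t Finₚ.≟ k
... | yes ≡.refl = hit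
... | no t≢k = subst (Position t) (Finₚ.punchIn-punchOut t≢k) (miss (punchOut t≢k))

insertAt-hit : ∀ {m} (t : Fin (suc m)) p (v : Vect m) → insertAt t p v t ≡ p
insertAt-hit t p v with t Finₚ.≟ t
... | yes _ = ≡.refl
... | no t≢t = contradiction ≡.refl t≢t

insertAt-miss : ∀ {m} (t : Fin (suc m)) p (v : Vect m) k → insertAt t p v (punchIn t k) ≡ v k
insertAt-miss t p v k with t Finₚ.≟ punchIn t k
... | yes t≡ = contradiction (≡.sym t≡) (Finₚ.punchInᵢ≢i t k)
... | no t≢ = cong v (≡.trans (Finₚ.punchOut-cong t ≡.refl) (Finₚ.punchOut-punchIn t))

-- Universal property of `insertAt`: the pointwise identities below follow by checking the
-- coordinate t and the coordinates off t, without unfolding `punchOut` again.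
insertAt-unique : ∀ {m} (t : Fin (suc m)) {p} {v : Vect m} {c : Vect (suc m)} →
  c t ≡ p → c ∘ punchIn t ≗ v → insertAt t p v ≗ c
insertAt-unique t {p} {v} ct cv k with position t k
... | hit = ≡.trans (insertAt-hit t p v) (≡.sym ct)
... | miss k′ = ≡.trans (insertAt-miss t p v k′) (≡.sym (cv k′))

insertAt-cong : ∀ {m} (t : Fin (suc m)) {p q} {v w : Vect m} → p ≡ q → v ≗ w →
  insertAt t p v ≗ insertAt t q w
insertAt-cong t {q = q} {w = w} p≡q v≗w = insertAt-unique t
  (≡.trans (insertAt-hit t q w) (≡.sym p≡q))
  (λ k → ≡.trans (insertAt-miss t q w k) (≡.sym (v≗w k)))

insertAt-moveOut : ∀ {m} (t : Fin (suc m)) p (v : Vect m) i j →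
  insertAt t p (moveOut v i j) ≗ moveOut (insertAt t p v) (punchIn t i) (punchIn t j)
insertAt-moveOut t p v i j = insertAt-unique t
  (≡.trans (moveOut-other (insertAt t p v) (Finₚ.punchInᵢ≢i t i ∘ ≡.sym) (Finₚ.punchInᵢ≢i t j ∘ ≡.sym)) (insertAt-hit t p v))
  (λ k → cong₂ ℤ._+_ (cong₂ ℤ._-_ (insertAt-miss t p v k) (e-punchIn t i k)) (e-punchIn t j k))

punchIn-fromℕ : ∀ {n} (i : Fin n) → punchIn (fromℕ n) i ≡ inject₁ i
punchIn-fromℕ zero = ≡.refl
punchIn-fromℕ (suc i) = cong suc (punchIn-fromℕ i)

punchIn-inject₁-fromℕ : ∀ {n} (t : Fin (suc n)) → punchIn (inject₁ t) (fromℕ n) ≡ fromℕ (suc n)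
punchIn-inject₁-fromℕ zero = ≡.refl
punchIn-inject₁-fromℕ {suc n} (suc t) = cong suc (punchIn-inject₁-fromℕ t)

punchIn-inject₁ : ∀ {n} (t : Fin (suc n)) k → punchIn (inject₁ t) (inject₁ k) ≡ inject₁ (punchIn t k)
punchIn-inject₁ zero k = ≡.refl
punchIn-inject₁ (suc t) zero = ≡.refl
punchIn-inject₁ (suc t) (suc k) = cong suc (punchIn-inject₁ t k)

-- Deleting the last index renames no other index, and deleting an earlier index leaves the last one
-- last. This is what allows the two orders of slicing to be compared fibre by fibre.
insertAt-last-comm : ∀ {m} (t : Fin (suc m)) p q (v : Vect m) →
  insertAt (fromℕ (suc m)) p (insertAt t q v) ≗ insertAt (inject₁ t) q (insertAt (fromℕ m) p v)
insertAt-last-comm {m} t p q v = insertAt-unique (fromℕ (suc m)) at-last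
  (λ k → ≡.sym (insertAt-unique t at-t rest k))
  where
  w : Vect (suc m)
  w = insertAt (fromℕ m) p v

  c : Vect (suc (suc m))
  c = insertAt (inject₁ t) q w

  at-last : c (fromℕ (suc m)) ≡ p
  at-last = ≡.trans (cong c (≡.sym (punchIn-inject₁-fromℕ t)))
    (≡.trans (insertAt-miss (inject₁ t) q w (fromℕ m)) (insertAt-hit (fromℕ m) p v))

  at-t : c (punchIn (fromℕ (suc m)) t) ≡ q
  at-t = ≡.trans (cong c (punchIn-fromℕ t)) (insertAt-hit (inject₁ t) q w)

  rest : ∀ k → c (punchIn (fromℕ (suc m)) (punchIn t k)) ≡ v k
  rest k = ≡.trans (cong c (≡.trans (punchIn-fromℕ (punchIn t k)) (≡.sym (punchIn-inject₁ t k))))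
    (≡.trans (insertAt-miss (inject₁ t) q w (inject₁ k))
    (≡.trans (cong w (≡.sym (punchIn-fromℕ k))) (insertAt-miss (fromℕ m) p v k)))

-- Integer inequalities and intervals.

p-1+1 : ∀ p → p ℤ.- 1ℤ ℤ.+ 1ℤ ≡ p
p-1+1 = solve-∀

p+1-1 : ∀ p → p ℤ.+ 1ℤ ℤ.- 1ℤ ≡ p
p+1-1 = solve-∀

-- Reduces a linear inequality to a known one with the same difference of sides, which leaves a ring
-- identity to the solver.
≤-shift : ∀ {i j k l} → l ℤ.- k ≡ j ℤ.- i → i ≤ j → k ≤ l
≤-shift eq i≤j = ℤₚ.0≤i-j⇒j≤i (subst (0ℤ ≤_) (≡.sym eq) (ℤₚ.i≤j⇒0≤j-i i≤j))

<⇒+1≤ : ∀ {i j} → i < j → i ℤ.+ 1ℤ ≤ j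
<⇒+1≤ {i} i<j = subst (_≤ _) (ℤₚ.+-comm 1ℤ i) (ℤₚ.i<j⇒suc[i]≤j i<j)

+1≤⇒< : ∀ {i j} → i ℤ.+ 1ℤ ≤ j → i < j
+1≤⇒< {i} i+1≤j = ℤₚ.suc[i]≤j⇒i<j (subst (_≤ _) (ℤₚ.+-comm i 1ℤ) i+1≤j)

p<p+1 : ∀ p → p < p ℤ.+ 1ℤ
p<p+1 p = +1≤⇒< ℤₚ.≤-refl

p-1<p : ∀ p → p ℤ.- 1ℤ < p
p-1<p p = subst (p ℤ.- 1ℤ <_) (p-1+1 p) (p<p+1 (p ℤ.- 1ℤ))

p-1<p+1 : ∀ p → p ℤ.- 1ℤ < p ℤ.+ 1ℤ
p-1<p+1 p = ℤₚ.<-trans (p-1<p p) (p<p+1 p)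

-- Recursive form of a half-open interval, so that sums over it telescope by induction;
-- `map-upTo≡range` brings the enumerations by `upTo` to this form.
range : ℤ → ℕ → List ℤ
range lo zero = []
range lo (suc N) = lo ∷ range (lo ℤ.+ 1ℤ) N

private
  step : ∀ lo N → lo ℤ.+ 1ℤ ℤ.+ + N ≡ lo ℤ.+ + suc N
  step lo N = ℤₚ.+-assoc lo 1ℤ (+ N)

∈-range⇒≥ : ∀ {p} lo N → p ∈ range lo N → lo ≤ p
∈-range⇒≥ lo (suc N) (here ≡.refl) = ℤₚ.≤-refl
∈-range⇒≥ lo (suc N) (there p∈) = ℤₚ.<⇒≤ (+1≤⇒< (∈-range⇒≥ (lo ℤ.+ 1ℤ) N p∈))

∈-range⇒< : ∀ {p} lo N → p ∈ range lo N → p < lo ℤ.+ + N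
∈-range⇒< lo (suc N) (here ≡.refl) = +1≤⇒< (ℤₚ.+-monoʳ-≤ lo (ℤ.+≤+ (ℕ.s≤s ℕ.z≤n)))
∈-range⇒< lo (suc N) (there p∈) = subst (_ <_) (step lo N) (∈-range⇒< (lo ℤ.+ 1ℤ) N p∈)

∈-range : ∀ {p} lo N → lo ≤ p → p < lo ℤ.+ + N → p ∈ range lo N
∈-range {p} lo zero lo≤p p<lo = contradiction (subst (p <_) (ℤₚ.+-identityʳ lo) p<lo) (ℤₚ.≤⇒≯ lo≤p)
∈-range {p} lo (suc N) lo≤p p<hi with p ℤₚ.≟ lo
... | yes p≡lo = here p≡lo
... | no p≢lo = there (∈-range (lo ℤ.+ 1ℤ) N (<⇒+1≤ (ℤₚ.≤∧≢⇒< lo≤p (p≢lo ∘ ≡.sym)))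
                  (subst (p <_) (≡.sym (step lo N)) p<hi))

map-upTo≡range : ∀ (g : ℕ → ℤ) lo → (∀ k → g k ≡ lo ℤ.+ + k) → ∀ N → map g (upTo N) ≡ range lo N
map-upTo≡range g lo g≡ N = ≡.trans (Listₚ.map-applyUpTo (λ k → k) g N) (go g lo g≡ N)
  where
  go : ∀ (g : ℕ → ℤ) lo → (∀ k → g k ≡ lo ℤ.+ + k) → ∀ N → List.applyUpTo g N ≡ range lo N
  go g lo g≡ zero = ≡.refl
  go g lo g≡ (suc N) = cong₂ _∷_ (≡.trans (g≡ 0) (ℤₚ.+-identityʳ lo))
    (go (g ∘ suc) (lo ℤ.+ 1ℤ) (λ k → ≡.trans (g≡ (suc k)) (≡.sym (step lo k))) N)

-- M-convex sets

any-true⇒∃ : ∀ {A : Set} (p : A → Bool) xs → any p xs ≡ true → ∃ λ x → p x ≡ true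
any-true⇒∃ p (x ∷ xs) eq with p x in px
... | true = x , px
... | false = any-true⇒∃ p xs eq

any-true : ∀ {A : Set} (p : A → Bool) {x xs} → x ∈ xs → p x ≡ true → any p xs ≡ true
any-true p (here ≡.refl) px rewrite px = ≡.refl
any-true p {xs = y ∷ _} (there x∈) px with p y
... | true = ≡.refl
... | false = any-true p x∈ px

-- Vectors are functions, so the enumeration contains a given one only up to pointwise equality.
-- Hence the field `resp` in `MConvex`.
allVecs-complete : ∀ {n} xs {a : Vect n} → (∀ i → a i ∈ xs) → ∃ λ v → v ∈ allVecs n xs × v ≗ a
allVecs-complete {zero} xs a∈ = _ , here ≡.refl , λ ()
allVecs-complete {suc n} xs a∈ with allVecs-complete xs (a∈ ∘ suc)
... | v , v∈ , v≗ = _ , ∈-concatMap⁺ _ (lose (a∈ zero) (∈-map⁺ _ v∈)) , λ { zero → ≡.refl ; (suc k) → v≗ k }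

slice : ∀ {n} → (Vect (suc n) → Bool) → Fin (suc n) → ℤ → Vect n → Bool
slice S t p v = S (insertAt t p v)

module Convexity (xs : List ℤ) where

  -- `lower` and `raise` are the two one-sided halves of the exchange axiom: only a is moved,
  -- towards b. Internal activity of the last index uses the first, external activity the second.
  -- `boxed` makes the set finite and enumerable by one list `xs` that also serves all its slices.
  record MConvex {n} (S : Vect n → Bool) : Set where
    field
      resp  : ∀ {a b} → a ≗ b → S a ≡ S b
      boxed : ∀ {a} → S a ≡ true → ∀ i → a i ∈ xs
      lower : ∀ {a b} i → S a ≡ true → S b ≡ true → b i < a i →
              ∃ λ j → a j < b j × S (moveOut a i j) ≡ true
      raise : ∀ {a b} i → S a ≡ true → S b ≡ true → a i < b i →
              ∃ λ j → b j < a j × S (moveOut a j i) ≡ true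

    resp-true : ∀ {a b} → a ≗ b → S a ≡ true → S b ≡ true
    resp-true a≗b Sa = ≡.trans (≡.sym (resp a≗b)) Sa

  open MConvex public

  inhabited : ∀ {n} → (Vect n → Bool) → Bool
  inhabited S = any S (allVecs _ xs)

  inhabited⇒∃ : ∀ {n} (S : Vect n → Bool) → inhabited S ≡ true → ∃ λ a → S a ≡ true
  inhabited⇒∃ S = any-true⇒∃ S (allVecs _ xs)

  ∃⇒inhabited : ∀ {n} {S : Vect n → Bool} → MConvex S → ∀ {a} → S a ≡ true → inhabited S ≡ true
  ∃⇒inhabited {S = S} C Sa with allVecs-complete xs (boxed C Sa)
  ... | v , v∈ , v≗a = any-true S v∈ (resp-true C (≡.sym ∘ v≗a) Sa)

  ¬inhabited⇒¬∃ : ∀ {n} {S : Vect n → Bool} → MConvex S → inhabited S ≡ false → ∀ a → S a ≡ false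
  ¬inhabited⇒¬∃ {S = S} C none a with S a in Sa
  ... | false = ≡.refl
  ... | true = contradiction (≡.trans (≡.sym (∃⇒inhabited C Sa)) none) λ ()

  -- Two points of a slice agree at t, whereas they differ at the exchange partner j. So j is not t,
  -- and the exchanged point stays in the slice.
  slice-MConvex : ∀ {n} {S : Vect (suc n) → Bool} → MConvex S → ∀ t p → MConvex (slice S t p)
  slice-MConvex {S = S} C t p = record
    { resp  = λ a≗b → resp C (insertAt-cong t ≡.refl a≗b)
    ; boxed = λ {a} Sa i → subst (_∈ xs) (insertAt-miss t p a i) (boxed C Sa (punchIn t i))
    ; lower = λ {a} {b} i Sa Sb b<a → down a b i
        (lower C (punchIn t i) Sa Sb
          (subst₂ _<_ (≡.sym (insertAt-miss t p b i)) (≡.sym (insertAt-miss t p a i)) b<a))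
    ; raise = λ {a} {b} i Sa Sb a<b → up a b i
        (raise C (punchIn t i) Sa Sb
          (subst₂ _<_ (≡.sym (insertAt-miss t p a i)) (≡.sym (insertAt-miss t p b i)) a<b))
    }
    where
    down : ∀ a b i → (∃ λ j → insertAt t p a j < insertAt t p b j × S (moveOut (insertAt t p a) (punchIn t i) j) ≡ true) →
           ∃ λ j → a j < b j × S (insertAt t p (moveOut a i j)) ≡ true
    down a b i (j , a<b , Sc) with position t j
    ... | hit = contradiction (subst₂ _<_ (insertAt-hit t p a) (insertAt-hit t p b) a<b) (ℤₚ.<-irrefl ≡.refl)
    ... | miss k = k , subst₂ _<_ (insertAt-miss t p a k) (insertAt-miss t p b k) a<b ,
                   resp-true C (≡.sym ∘ insertAt-moveOut t p a i k) Sc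

    up : ∀ a b i → (∃ λ j → insertAt t p b j < insertAt t p a j × S (moveOut (insertAt t p a) j (punchIn t i)) ≡ true) →
         ∃ λ j → b j < a j × S (insertAt t p (moveOut a j i)) ≡ true
    up a b i (j , b<a , Sc) with position t j
    ... | hit = contradiction (subst₂ _<_ (insertAt-hit t p b) (insertAt-hit t p a) b<a) (ℤₚ.<-irrefl ≡.refl)
    ... | miss k = k , subst₂ _<_ (insertAt-miss t p b k) (insertAt-miss t p a k) b<a ,
                   resp-true C (≡.sym ∘ insertAt-moveOut t p a k i) Sc

  -- Projection of an M-convex set onto two coordinates.

  module Planar {n} {S : Vect n → Bool} (C : MConvex S) where

    At : (u t : Fin n) → ℤ → ℤ → Set
    At u t p q = ∃ λ a → S a ≡ true × a u ≡ p × a t ≡ q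

    swap : ∀ {u t p q} → At u t p q → At t u q p
    swap (a , Sa , au , at) = a , Sa , at , au

    cast : ∀ {u t p p′ q q′} → p ≡ p′ → q ≡ q′ → At u t p q → At u t p′ q′
    cast ≡.refl ≡.refl a = a

    module _ {u t : Fin n} (u≢t : u ≢ t) where

      moved : ∀ a {p q} → S (moveOut a u t) ≡ true → a u ≡ p → a t ≡ q → At u t (p ℤ.- 1ℤ) (q ℤ.+ 1ℤ)
      moved a Sc ≡.refl ≡.refl = moveOut a u t , Sc , moveOut-source a u≢t , moveOut-target a u≢t

      -- In the projection an exchange that lowers u is a step (-1,+1) if its partner is t, and a
      -- step (-1,0) otherwise. The inequality a t < b t is kept in the first case because it rules
      -- that case out whenever b is not higher in t.
      lower-cases : ∀ {a b} → S a ≡ true → S b ≡ true → b u < a u →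
        (S (moveOut a u t) ≡ true × a t < b t) ⊎ At u t (a u ℤ.- 1ℤ) (a t)
      lower-cases {a} {b} Sa Sb b<a with lower C u Sa Sb b<a
      ... | j , a<b , Sc with j Finₚ.≟ t
      ... | yes ≡.refl = inj₁ (Sc , a<b)
      ... | no j≢t = inj₂ (_ , Sc , moveOut-source a u≢j , moveOut-other a (u≢t ∘ ≡.sym) (j≢t ∘ ≡.sym))
        where
        u≢j : u ≢ j
        u≢j ≡.refl = ℤₚ.<-asym a<b b<a

      raise-cases : ∀ {a b} → S a ≡ true → S b ≡ true → a u < b u →
        (S (moveOut a t u) ≡ true × b t < a t) ⊎ At u t (a u ℤ.+ 1ℤ) (a t)
      raise-cases {a} {b} Sa Sb a<b with raise C u Sa Sb a<b
      ... | j , b<a , Sc with j Finₚ.≟ t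
      ... | yes ≡.refl = inj₁ (Sc , b<a)
      ... | no j≢t = inj₂ (_ , Sc , moveOut-target a (u≢j ∘ ≡.sym) , moveOut-other a (j≢t ∘ ≡.sym) (u≢t ∘ ≡.sym))
        where
        u≢j : u ≢ j
        u≢j ≡.refl = ℤₚ.<-asym a<b b<a

    module _ {u t : Fin n} (u≢t : u ≢ t) {p q : ℤ} where

      private
        t≢u : t ≢ u
        t≢u = u≢t ∘ ≡.sym

      -- Makes a global question local: whether the value p - 1 occurs anywhere in coordinate u is
      -- decided by two neighbours of (p,q). These are the neighbours that enter the slice factors.
      down : At u t p q → ∃ (λ b → S b ≡ true × b u ≡ p ℤ.- 1ℤ) →
        At u t (p ℤ.- 1ℤ) q ⊎ At u t (p ℤ.- 1ℤ) (q ℤ.+ 1ℤ)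
      down (a , Sa , ≡.refl , ≡.refl) (b , Sb , bu) with lower-cases u≢t Sa Sb (subst (_< a u) (≡.sym bu) (p-1<p (a u)))
      ... | inj₁ (Sc , _) = inj₂ (moved u≢t a Sc ≡.refl ≡.refl)
      ... | inj₂ c = inj₁ c

      up : At u t p q → ∃ (λ b → S b ≡ true × b u ≡ p ℤ.+ 1ℤ) →
        At u t (p ℤ.+ 1ℤ) q ⊎ At u t (p ℤ.+ 1ℤ) (q ℤ.- 1ℤ)
      up (a , Sa , ≡.refl , ≡.refl) (b , Sb , bu) with raise-cases u≢t Sa Sb (subst (a u <_) (≡.sym bu) (p<p+1 (a u)))
      ... | inj₁ (Sc , _) = inj₂ (swap (moved t≢u a Sc ≡.refl ≡.refl))
      ... | inj₂ c = inj₁ c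

      -- With `south`, `northwest` and their mirror images under exchange of the two coordinates,
      -- this gives all the implications between neighbours of (p,q) that the hexagon identity
      -- needs.
      north : At u t (p ℤ.+ 1ℤ) q → At u t (p ℤ.- 1ℤ) (q ℤ.+ 1ℤ) → At u t p (q ℤ.+ 1ℤ)
      north (a , Sa , au , at) (b , Sb , bu , bt)
        with raise-cases t≢u Sa Sb (subst₂ _<_ (≡.sym at) (≡.sym bt) (p<p+1 q))
      ... | inj₁ (Sc , _) = cast (p+1-1 p) ≡.refl (moved u≢t a Sc au at)
      ... | inj₂ (c , Sc , ct , cu)
        -- Here c lies over (p+1,q+1). It agrees with b in coordinate t, so the exchange from b
        -- towards c cannot use t and ends over (p,q+1).
        with raise-cases u≢t Sb Sc (subst₂ _<_ (≡.sym bu) (≡.sym (≡.trans cu au)) (p-1<p+1 p))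
      ... | inj₁ (_ , c<b) = contradiction c<b (ℤₚ.<-irrefl (≡.trans ct (≡.trans (cong (ℤ._+ 1ℤ) at) (≡.sym bt))))
      ... | inj₂ d = cast (≡.trans (cong (ℤ._+ 1ℤ) bu) (p-1+1 p)) bt d

      south : At u t (p ℤ.- 1ℤ) q → At u t (p ℤ.+ 1ℤ) (q ℤ.- 1ℤ) → At u t p (q ℤ.- 1ℤ)
      south (a , Sa , au , at) (b , Sb , bu , bt)
        with lower-cases t≢u Sa Sb (subst₂ _<_ (≡.sym bt) (≡.sym at) (p-1<p q))
      ... | inj₁ (Sc , _) = cast (p-1+1 p) ≡.refl (swap (moved t≢u a Sc at au))
      ... | inj₂ (c , Sc , ct , cu)
        with lower-cases u≢t Sb Sc (subst₂ _<_ (≡.sym (≡.trans cu au)) (≡.sym bu) (p-1<p+1 p))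
      ... | inj₁ (_ , b<c) = contradiction b<c (ℤₚ.<-irrefl (≡.trans bt (≡.sym (≡.trans ct (cong (ℤ._- 1ℤ) at)))))
      ... | inj₂ d = cast (≡.trans (cong (ℤ._- 1ℤ) bu) (p+1-1 p)) bt d

      northwest : At u t p (q ℤ.+ 1ℤ) → At u t (p ℤ.- 1ℤ) q → At u t (p ℤ.- 1ℤ) (q ℤ.+ 1ℤ)
      northwest (a , Sa , au , at) (b , Sb , bu , bt)
        with lower-cases u≢t Sa Sb (subst₂ _<_ (≡.sym bu) (≡.sym au) (p-1<p p))
      ... | inj₁ (_ , a<b) = contradiction (subst₂ _<_ at bt a<b) (ℤₚ.<-asym (p<p+1 q))
      ... | inj₂ d = cast (cong (ℤ._- 1ℤ) au) at d

      module _ {a b} (Sa : S a ≡ true) (Sb : S b ≡ true)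
               (au : a u ≡ p) (at : a t ≡ q) (bu : b u ≡ p ℤ.+ 1ℤ) (bt : b t ≡ q ℤ.- 1ℤ) where

        private
          a<b : a u < b u
          a<b = subst₂ _<_ (≡.sym au) (≡.sym bu) (p<p+1 p)

          b<a : b t < a t
          b<a = subst₂ _<_ (≡.sym bt) (≡.sym at) (p-1<p q)

        -- The exchange raising u must take its unit from t, since any other partner would give a
        -- point over the missing (p+1,q). The moved point therefore keeps all remaining coordinates
        -- of a, which is what makes neighbouring fibres comparable. The next three lemmas vary the
        -- starting point and the missing neighbour.
        ¬east⇒southeast : ¬ At u t (p ℤ.+ 1ℤ) q → S (moveOut a t u) ≡ true
        ¬east⇒southeast ¬E with raise-cases u≢t Sa Sb a<b
        ... | inj₁ (Sc , _) = Sc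
        ... | inj₂ d = contradiction (cast (cong (ℤ._+ 1ℤ) au) at d) ¬E

        ¬east⇒northwest : ¬ At u t (p ℤ.+ 1ℤ) q → S (moveOut b u t) ≡ true
        ¬east⇒northwest ¬E with raise-cases t≢u Sb Sa b<a
        ... | inj₁ (Sc , _) = Sc
        ... | inj₂ d = contradiction (cast bu (≡.trans (cong (ℤ._+ 1ℤ) bt) (p-1+1 q)) (swap d)) ¬E

        ¬south⇒southeast : ¬ At u t p (q ℤ.- 1ℤ) → S (moveOut a t u) ≡ true
        ¬south⇒southeast ¬So with lower-cases t≢u Sa Sb b<a
        ... | inj₁ (Sc , _) = Sc
        ... | inj₂ d = contradiction (cast au (cong (ℤ._- 1ℤ) at) (swap d)) ¬So

        ¬south⇒northwest : ¬ At u t p (q ℤ.- 1ℤ) → S (moveOut b u t) ≡ true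
        ¬south⇒northwest ¬So with lower-cases u≢t Sb Sa a<b
        ... | inj₁ (Sc , _) = Sc
        ... | inj₂ d = contradiction (cast (≡.trans (cong (ℤ._- 1ℤ) bu) (p+1-1 p)) bt d) ¬So

-- Finite sums in a commutative ring.

module Sums {c ℓ} (R : CommutativeRing c ℓ) where
  open CommutativeRing R hiding (zero)
  open import Relation.Binary.Reasoning.Setoid setoid
  open import Algebra.Properties.CommutativeSemigroup +-commutativeSemigroup using (interchange)

  infixl 7 _when_
  _when_ : Carrier → Bool → Carrier
  a when b = if b then a else 0#

  when-cong : ∀ {a a′} b → (b ≡ true → a ≈ a′) → a when b ≈ a′ when b
  when-cong true a≈a′ = a≈a′ ≡.refl
  when-cong false _ = refl

  ∑ : {A : Set} → List A → (A → Carrier) → Carrier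
  ∑ xs F = foldr (λ a s → F a + s) 0# xs

  module _ {A : Set} where

    ∑-cong : ∀ (xs : List A) {F G} → (∀ {a} → a ∈ xs → F a ≈ G a) → ∑ xs F ≈ ∑ xs G
    ∑-cong [] F≈G = refl
    ∑-cong (x ∷ xs) F≈G = +-cong (F≈G (here ≡.refl)) (∑-cong xs (F≈G ∘ there))

    ∑-zero : ∀ (xs : List A) {F} → (∀ {a} → a ∈ xs → F a ≈ 0#) → ∑ xs F ≈ 0#
    ∑-zero [] F≈0 = refl
    ∑-zero (x ∷ xs) F≈0 = trans (+-cong (F≈0 (here ≡.refl)) (∑-zero xs (F≈0 ∘ there))) (+-identityˡ 0#)

    ∑-+ : ∀ (xs : List A) F G → ∑ xs (λ a → F a + G a) ≈ ∑ xs F + ∑ xs G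
    ∑-+ [] F G = sym (+-identityˡ 0#)
    ∑-+ (x ∷ xs) F G = trans (+-congˡ (∑-+ xs F G)) (interchange (F x) (G x) (∑ xs F) (∑ xs G))

    ∑-*ˡ : ∀ k (xs : List A) F → ∑ xs (λ a → k * F a) ≈ k * ∑ xs F
    ∑-*ˡ k [] F = sym (zeroʳ k)
    ∑-*ˡ k (x ∷ xs) F = trans (+-congˡ (∑-*ˡ k xs F)) (sym (distribˡ k (F x) (∑ xs F)))

    ∑-++ : ∀ (xs ys : List A) F → ∑ (xs ++ ys) F ≈ ∑ xs F + ∑ ys F
    ∑-++ [] ys F = sym (+-identityˡ _)
    ∑-++ (x ∷ xs) ys F = trans (+-congˡ (∑-++ xs ys F)) (sym (+-assoc (F x) _ _))

    ∑-filterᵇ : ∀ p (xs : List A) F → ∑ (filterᵇ p xs) F ≈ ∑ xs (λ a → F a when p a)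
    ∑-filterᵇ p [] F = refl
    ∑-filterᵇ p (x ∷ xs) F with p x
    ... | true = +-congˡ (∑-filterᵇ p xs F)
    ... | false = trans (∑-filterᵇ p xs F) (sym (+-identityˡ _))

  module _ {A B : Set} where

    ∑-swap : ∀ (xs : List A) (ys : List B) (F : A → B → Carrier) → ∑ xs (λ a → ∑ ys (F a)) ≈ ∑ ys (λ b → ∑ xs (λ a → F a b))
    ∑-swap [] ys F = sym (∑-zero ys (λ _ → refl))
    ∑-swap (x ∷ xs) ys F = trans (+-congˡ (∑-swap xs ys F)) (sym (∑-+ ys (F x) (λ b → ∑ xs (λ a → F a b))))

    ∑-map : ∀ (g : B → A) xs F → ∑ (map g xs) F ≈ ∑ xs (F ∘ g)
    ∑-map g [] F = refl
    ∑-map g (x ∷ xs) F = +-congˡ (∑-map g xs F)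

    ∑-concatMap : ∀ (g : B → List A) xs F → ∑ (concatMap g xs) F ≈ ∑ xs (λ b → ∑ (g b) F)
    ∑-concatMap g [] F = refl
    ∑-concatMap g (x ∷ xs) F = trans (∑-++ (g x) _ F) (+-congˡ (∑-concatMap g xs F))

  ∑-concatMap-map : ∀ {A B D : Set} (g : B → D → A) xs ys F →
    ∑ (concatMap (λ b → map (g b) ys) xs) F ≈ ∑ xs (λ b → ∑ ys (F ∘ g b))
  ∑-concatMap-map g xs ys F = trans (∑-concatMap _ xs F) (∑-cong xs (λ {b} _ → ∑-map (g b) ys F))

  ∑-range-telescope : ∀ lo N F →
    F lo + ∑ (range lo N) (λ p → F (p ℤ.+ 1ℤ)) ≈ ∑ (range lo N) F + F (lo ℤ.+ + N)
  ∑-range-telescope lo zero F = trans (+-comm _ _) (+-congˡ (reflexive (cong F (≡.sym (ℤₚ.+-identityʳ lo)))))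
  ∑-range-telescope lo (suc N) F = begin
    F lo + (F lo⁺ + ∑ (range lo⁺ N) (λ p → F (p ℤ.+ 1ℤ)))
      ≈⟨ +-congˡ (∑-range-telescope lo⁺ N F) ⟩
    F lo + (∑ (range lo⁺ N) F + F (lo⁺ ℤ.+ + N))
      ≈⟨ +-assoc _ _ _ ⟨
    F lo + ∑ (range lo⁺ N) F + F (lo⁺ ℤ.+ + N)
      ≈⟨ +-congˡ (reflexive (cong F (ℤₚ.+-assoc lo 1ℤ (+ N)))) ⟩
    F lo + ∑ (range lo⁺ N) F + F (lo ℤ.+ + suc N) ∎
    where lo⁺ = lo ℤ.+ 1ℤ

  -- The shift loses the term at lo and gains the one at lo + N, just past the end of the range.
  ∑-range-shift : ∀ lo N {F} → F lo ≈ 0# → F (lo ℤ.+ + N) ≈ 0# →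
    ∑ (range lo N) F ≈ ∑ (range lo N) (λ p → F (p ℤ.+ 1ℤ))
  ∑-range-shift lo N {F} F-lo F-hi = begin
    ∑ (range lo N) F                               ≈⟨ +-identityʳ _ ⟨
    ∑ (range lo N) F + 0#                          ≈⟨ +-congˡ F-hi ⟨
    ∑ (range lo N) F + F (lo ℤ.+ + N)              ≈⟨ ∑-range-telescope lo N F ⟨
    F lo + ∑ (range lo N) (λ p → F (p ℤ.+ 1ℤ))     ≈⟨ +-congʳ F-lo ⟩
    0# + ∑ (range lo N) (λ p → F (p ℤ.+ 1ℤ))       ≈⟨ +-identityˡ _ ⟩
    ∑ (range lo N) (λ p → F (p ℤ.+ 1ℤ))            ∎

  ∑-range-δ-outside : ∀ lo N p → ¬ (p ∈ range lo N) → ∑ (range lo N) (λ j → 1# when ⌊ p ℤₚ.≟ j ⌋) ≈ 0#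
  ∑-range-δ-outside lo zero p p∉ = refl
  ∑-range-δ-outside lo (suc N) p p∉ with p ℤₚ.≟ lo
  ... | yes p≡lo = contradiction (here p≡lo) p∉
  ... | no _ = trans (+-identityˡ _) (∑-range-δ-outside (lo ℤ.+ 1ℤ) N p (p∉ ∘ there))

  ∑-range-δ-inside : ∀ lo N p → p ∈ range lo N → ∑ (range lo N) (λ j → 1# when ⌊ p ℤₚ.≟ j ⌋) ≈ 1#
  ∑-range-δ-inside lo (suc N) p p∈ with p ℤₚ.≟ lo
  ... | yes ≡.refl = trans (+-congˡ (∑-range-δ-outside (lo ℤ.+ 1ℤ) N p
                       (λ p∈′ → ℤₚ.≤⇒≯ (∈-range⇒≥ (p ℤ.+ 1ℤ) N p∈′) (p<p+1 p))))
                       (+-identityʳ 1#)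
  ∑-range-δ-inside lo (suc N) p (here p≡lo) | no p≢lo = contradiction p≡lo p≢lo
  ∑-range-δ-inside lo (suc N) p (there p∈) | no _ =
    trans (+-identityˡ _) (∑-range-δ-inside (lo ℤ.+ 1ℤ) N p p∈)

  -- `allVecs` branches on coordinate zero first. For a later t that coordinate is split off, the
  -- induction hypothesis separates t, the two outer sums are swapped, and coordinate zero is put
  -- back.
  ∑-insertAt : ∀ {n} xs (t : Fin (suc n)) {F : Vect (suc n) → Carrier} → (∀ {a b} → a ≗ b → F a ≈ F b) →
    ∑ (allVecs (suc n) xs) F ≈ ∑ xs (λ p → ∑ (allVecs n xs) (λ v → F (insertAt t p v)))
  ∑-insertAt {n} xs zero {F} F-cong = trans (∑-concatMap-map _ xs (allVecs n xs) F)
    (∑-cong xs λ _ → ∑-cong (allVecs n xs) λ _ → F-cong λ { zero → ≡.refl ; (suc k) → ≡.refl })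
  ∑-insertAt {suc n} xs (suc t) {F} F-cong = begin
    ∑ (allVecs (suc (suc n)) xs) F
      ≈⟨ ∑-insertAt xs zero F-cong ⟩
    ∑ xs (λ p₀ → ∑ (allVecs (suc n) xs) (λ v → F (insertAt zero p₀ v)))
      ≈⟨ ∑-cong xs (λ {p₀} _ → ∑-insertAt xs t (λ a≗b → F-cong (insertAt-cong zero {p = p₀} ≡.refl a≗b))) ⟩
    ∑ xs (λ p₀ → ∑ xs (λ p → ∑ (allVecs n xs) (λ v → F (insertAt zero p₀ (insertAt t p v)))))
      ≈⟨ ∑-swap xs xs (λ p₀ p → ∑ (allVecs n xs) (λ v → F (insertAt zero p₀ (insertAt t p v)))) ⟩
    ∑ xs (λ p → ∑ xs (λ p₀ → ∑ (allVecs n xs) (λ v → F (insertAt zero p₀ (insertAt t p v)))))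
      ≈⟨ ∑-cong xs (λ {p} _ → ∑-cong xs λ {p₀} _ → ∑-cong (allVecs n xs) λ {v} _ → F-cong (≡.sym ∘ commute p p₀ v)) ⟩
    ∑ xs (λ p → ∑ xs (λ p₀ → ∑ (allVecs n xs) (λ v → F (insertAt (suc t) p (insertAt zero p₀ v)))))
      ≈⟨ ∑-cong xs (λ {p} _ → ∑-insertAt xs zero (λ a≗b → F-cong (insertAt-cong (suc t) {p = p} ≡.refl a≗b))) ⟨
    ∑ xs (λ p → ∑ (allVecs (suc n) xs) (λ v → F (insertAt (suc t) p v))) ∎
    where
    commute : ∀ p p₀ (v : Vect n) →
      insertAt (suc t) p (insertAt zero p₀ v) ≗ insertAt zero p₀ (insertAt t p v)
    commute p p₀ v = insertAt-unique (suc t) (insertAt-hit t p v)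
      λ { zero → ≡.refl ; (suc k) → insertAt-miss t p v k }

-- Activities and the weight of a point.

all-true⁻ : ∀ {A : Set} (p : A → Bool) {x} xs → all p xs ≡ true → x ∈ xs → p x ≡ true
all-true⁻ p (y ∷ xs) eq x∈ with p y in py
all-true⁻ p (y ∷ xs) eq (here ≡.refl) | true = py
all-true⁻ p (y ∷ xs) eq (there x∈) | true = all-true⁻ p xs eq x∈

all-true⁺ : ∀ {A : Set} (p : A → Bool) xs → (∀ {x} → x ∈ xs → p x ≡ true) → all p xs ≡ true
all-true⁺ p [] h = ≡.refl
all-true⁺ p (y ∷ xs) h rewrite h (here ≡.refl) = all-true⁺ p xs (h ∘ there)

-- Specialises to internal and to external activity: M j tells whether the move between i and j stays in the set.
unmovable : ∀ {n} → (Fin n → Bool) → Fin n → Bool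
unmovable {n} M i = all (λ j → if ⌊ j Finₚ.<? i ⌋ then not (M j) else true) (allFin n)

module _ {n} (M : Fin n → Bool) where

  unmovable⁻ : ∀ i → unmovable M i ≡ true → ∀ {j} → j Fin.< i → M j ≡ false
  unmovable⁻ i eq {j} j<i with j Finₚ.<? i | all-true⁻ _ (allFin n) eq (∈-allFin j)
  ... | yes _ | ¬Mj = not-injective ¬Mj
  ... | no j≮i | _ = contradiction j<i j≮i

  unmovable⁺ : ∀ i → (∀ {j} → j Fin.< i → M j ≡ false) → unmovable M i ≡ true
  unmovable⁺ i fixed = all-true⁺ _ (allFin n) (λ {j} _ → at j)
    where
    at : ∀ j → (if ⌊ j Finₚ.<? i ⌋ then not (M j) else true) ≡ true
    at j with j Finₚ.<? i
    ... | yes j<i = cong not (fixed j<i)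
    ... | no _ = ≡.refl

unmovable-cong : ∀ {n} {M M′ : Fin n → Bool} → M ≗ M′ → unmovable M ≗ unmovable M′
unmovable-cong {M = M} {M′} M≗M′ i = iff⇒≡
  (λ eq → unmovable⁺ M′ i λ {j} j<i → ≡.trans (≡.sym (M≗M′ j)) (unmovable⁻ M i eq j<i))
  (λ eq → unmovable⁺ M i λ {j} j<i → ≡.trans (M≗M′ j) (unmovable⁻ M′ i eq j<i))

punchIn-fromℕ-< : ∀ {n} (k : Fin n) → punchIn (fromℕ n) k Fin.< fromℕ n
punchIn-fromℕ-< {n} k rewrite punchIn-fromℕ k | Finₚ.toℕ-inject₁ k | Finₚ.toℕ-fromℕ n = Finₚ.toℕ<n k

toℕ-punchIn-fromℕ : ∀ {n} (k : Fin n) → Fin.toℕ (punchIn (fromℕ n) k) ≡ Fin.toℕ k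
toℕ-punchIn-fromℕ k = ≡.trans (cong Fin.toℕ (punchIn-fromℕ k)) (Finₚ.toℕ-inject₁ k)

module _ {n} (M : Fin (suc n) → Bool) where

  -- The last index lies below no other index, so it is never a candidate partner for i. For a
  -- general deleted index this fails, which is why the last coordinate is sliced first.
  unmovable-rest : ∀ i → unmovable M (punchIn (fromℕ n) i) ≡ unmovable (M ∘ punchIn (fromℕ n)) i
  unmovable-rest i = iff⇒≡
    (λ eq → unmovable⁺ _ i λ {j} j<i → unmovable⁻ M _ eq
      (subst₂ ℕ._<_ (≡.sym (toℕ-punchIn-fromℕ j)) (≡.sym (toℕ-punchIn-fromℕ i)) j<i))
    (λ eq → unmovable⁺ M _ λ {j} → below (unmovable⁻ _ i eq) (position (fromℕ n) j))
    where
    below : (∀ {j} → j Fin.< i → M (punchIn (fromℕ n) j) ≡ false) →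
            ∀ {j} → Position (fromℕ n) j → j Fin.< punchIn (fromℕ n) i → M j ≡ false
    below fixed hit L<i = contradiction L<i (ℕₚ.<-asym (punchIn-fromℕ-< i))
    below fixed (miss k) k<i = fixed (subst₂ ℕ._<_ (toℕ-punchIn-fromℕ k) (toℕ-punchIn-fromℕ i) k<i)

  -- Every other index lies below the last one, so nothing but the existence of some move matters; b
  -- is any Boolean that decides it.
  unmovable-last : ∀ b → (∀ k → M (punchIn (fromℕ n) k) ≡ true → b ≡ true) →
    (b ≡ true → ∃ λ k → M (punchIn (fromℕ n) k) ≡ true) → unmovable M (fromℕ n) ≡ not b
  unmovable-last false M⇒b b⇒M = unmovable⁺ M _ λ {j} j<L → below (position (fromℕ n) j) j<L
    where
    below : ∀ {j} → Position (fromℕ n) j → j Fin.< fromℕ n → M j ≡ false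
    below hit L<L = contradiction L<L (ℕₚ.<-irrefl ≡.refl)
    below (miss k) _ with M (punchIn (fromℕ n) k) in Mk
    ... | false = ≡.refl
    ... | true = ≡.sym (M⇒b k Mk)
  unmovable-last true M⇒b b⇒M with b⇒M ≡.refl
  ... | k , Mk = ¬-not λ eq → not-¬ Mk (unmovable⁻ M (fromℕ n) eq (punchIn-fromℕ-< k))

indicator : Bool → ℕ
indicator b = if b then 1 else 0

sumℕ-cong : ∀ {n} {g h : Fin n → ℕ} → g ≗ h → sumℕ g ≡ sumℕ h
sumℕ-cong {zero} g≗h = ≡.refl
sumℕ-cong {suc n} g≗h = cong₂ ℕ._+_ (g≗h zero) (sumℕ-cong (g≗h ∘ suc))

sumℕ-punchIn : ∀ {n} (t : Fin (suc n)) g → sumℕ g ≡ g t ℕ.+ sumℕ (g ∘ punchIn t)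
sumℕ-punchIn zero g = ≡.refl
sumℕ-punchIn {suc n} (suc t) g = ≡.trans (cong (g zero ℕ.+_) (sumℕ-punchIn t (g ∘ suc)))
  (x∙yz≈y∙xz (g zero) (g (suc t)) _)
  where open import Algebra.Properties.CommutativeSemigroup ℕₚ.+-commutativeSemigroup using (x∙yz≈y∙xz)

length-filterᵇ-tabulate : ∀ {A : Set} {n} (p : A → Bool) (g : Fin n → A) →
  length (filterᵇ p (tabulate g)) ≡ sumℕ (indicator ∘ p ∘ g)
length-filterᵇ-tabulate {n = zero} p g = ≡.refl
length-filterᵇ-tabulate {n = suc n} p g with p (g zero)
... | true = cong suc (length-filterᵇ-tabulate p (g ∘ suc))
... | false = length-filterᵇ-tabulate p (g ∘ suc)

module ActivityWeight {c ℓ} (R : CommutativeRing c ℓ) (x y : CommutativeRing.Carrier R) where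
  open CommutativeRing R hiding (zero)
  open Tutte R
  open Sums R
  open import Relation.Binary.Reasoning.Setoid setoid
  open import Algebra.Definitions.RawSemiring (Algebra.Bundles.Semiring.rawSemiring semiring) using (_^_)
  open import Algebra.Properties.Semiring.Exp semiring using (^-homo-*)
  open import Algebra.Properties.CommutativeSemigroup *-commutativeSemigroup using (interchange)

  count≡sumℕ : ∀ {n} (p : Fin n → Bool) → count p ≡ sumℕ (indicator ∘ p)
  count≡sumℕ p = length-filterᵇ-tabulate p (λ i → i)

  count-cong : ∀ {n} {p q : Fin n → Bool} → p ≗ q → count p ≡ count q
  count-cong {p = p} {q} p≗q =
    ≡.trans (count≡sumℕ p) (≡.trans (sumℕ-cong (cong indicator ∘ p≗q)) (≡.sym (count≡sumℕ q)))

  count-punchIn : ∀ {n} (t : Fin (suc n)) p → count p ≡ indicator (p t) ℕ.+ count (p ∘ punchIn t)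
  count-punchIn t p = ≡.trans (count≡sumℕ p) (≡.trans (sumℕ-punchIn t (indicator ∘ p))
    (cong (indicator (p t) ℕ.+_) (≡.sym (count≡sumℕ (p ∘ punchIn t)))))

  z : Carrier
  z = x + y + (- 1#)

  activity : Bool → Bool → Carrier
  activity true  true  = z
  activity true  false = x
  activity false true  = y
  activity false false = 1#

  activityWeight : ∀ {n} → (Fin n → Bool) → (Fin n → Bool) → Carrier
  activityWeight int ext =
    (x ^ count (λ i → int i ∧ not (ext i))) *
    (y ^ count (λ i → ext i ∧ not (int i))) *
    (z ^ count (λ i → int i ∧ ext i))

  activityWeight-cong : ∀ {n} {int int′ ext ext′ : Fin n → Bool} → int ≗ int′ → ext ≗ ext′ →
    activityWeight int ext ≡ activityWeight int′ ext′
  activityWeight-cong int≗ ext≗ = cong₂ _*_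
    (cong₂ _*_
      (cong (x ^_) (count-cong λ i → cong₂ (λ a b → a ∧ not b) (int≗ i) (ext≗ i)))
      (cong (y ^_) (count-cong λ i → cong₂ (λ a b → a ∧ not b) (ext≗ i) (int≗ i))))
    (cong (z ^_) (count-cong λ i → cong₂ _∧_ (int≗ i) (ext≗ i)))

  activity-powers : ∀ i e → x ^ indicator (i ∧ not e) * y ^ indicator (e ∧ not i) * z ^ indicator (i ∧ e) ≈ activity i e
  activity-powers true true = trans (*-cong (*-identityˡ _) (*-identityʳ z)) (*-identityˡ z)
  activity-powers true false = trans (*-identityʳ _) (trans (*-identityʳ _) (*-identityʳ x))
  activity-powers false true = trans (*-identityʳ _) (trans (*-identityˡ _) (*-identityʳ y))
  activity-powers false false = trans (*-identityʳ _) (*-identityʳ _)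

  activityWeight-punchIn : ∀ {n} (t : Fin (suc n)) int ext →
    activityWeight int ext ≈ activity (int t) (ext t) * activityWeight (int ∘ punchIn t) (ext ∘ punchIn t)
  activityWeight-punchIn t int ext = begin
    activityWeight int ext
      ≈⟨ *-cong (*-cong (split x (λ i → int i ∧ not (ext i))) (split y (λ i → ext i ∧ not (int i))))
                (split z (λ i → int i ∧ ext i)) ⟩
    (x₁ * x₂) * (y₁ * y₂) * (z₁ * z₂)
      ≈⟨ *-congʳ (interchange x₁ x₂ y₁ y₂) ⟩
    (x₁ * y₁) * (x₂ * y₂) * (z₁ * z₂)
      ≈⟨ interchange (x₁ * y₁) (x₂ * y₂) z₁ z₂ ⟩
    (x₁ * y₁ * z₁) * (x₂ * y₂ * z₂)
      ≈⟨ *-congʳ (activity-powers (int t) (ext t)) ⟩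
    activity (int t) (ext t) * activityWeight (int ∘ punchIn t) (ext ∘ punchIn t) ∎
    where
    split : ∀ b p → b ^ count p ≈ b ^ indicator (p t) * b ^ count (p ∘ punchIn t)
    split b p = trans (reflexive (cong (b ^_) (count-punchIn t p))) (^-homo-* b (indicator (p t)) _)

    x₁ = x ^ indicator (int t ∧ not (ext t))
    y₁ = y ^ indicator (ext t ∧ not (int t))
    z₁ = z ^ indicator (int t ∧ ext t)
    x₂ = x ^ count (λ i → int (punchIn t i) ∧ not (ext (punchIn t i)))
    y₂ = y ^ count (λ i → ext (punchIn t i) ∧ not (int (punchIn t i)))
    z₂ = z ^ count (λ i → int (punchIn t i) ∧ ext (punchIn t i))

moveOut-cong : ∀ {n} {a b : Vect n} i j → a ≗ b → moveOut a i j ≗ moveOut b i j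
moveOut-cong i j a≗b k = cong (λ w → w ℤ.- e i k ℤ.+ e j k) (a≗b k)

moveIn-cong : ∀ {n} {a b : Vect n} i j → a ≗ b → moveIn a i j ≗ moveIn b i j
moveIn-cong i j a≗b k = cong (λ w → w ℤ.+ e i k ℤ.- e j k) (a≗b k)

insertAt-moveIn : ∀ {m} (t : Fin (suc m)) p (v : Vect m) i j →
  insertAt t p (moveIn v i j) ≗ moveIn (insertAt t p v) (punchIn t i) (punchIn t j)
insertAt-moveIn t p v i j k = ≡.trans (insertAt-cong t ≡.refl (moveIn≗moveOut v i j) k)
  (≡.trans (insertAt-moveOut t p v j i k) (≡.sym (moveIn≗moveOut (insertAt t p v) (punchIn t i) (punchIn t j) k)))

-- Weighted sums over M-convex sets and their slices.

module TutteRecursion {c ℓ} (R : CommutativeRing c ℓ) (x y : CommutativeRing.Carrier R)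
                      (lo : ℤ) (N : ℕ) where
  open CommutativeRing R hiding (zero)
  open Tutte R
  open Sums R
  open ActivityWeight R x y
  open import Relation.Binary.Reasoning.Setoid setoid

  xs : List ℤ
  xs = range lo N

  open Convexity xs

  weight-cong : ∀ {n} {S S′ : Vect n → Bool} {a b} → (∀ {c d} → c ≗ d → S c ≡ S′ d) → a ≗ b →
    weight S x y a ≡ weight S′ x y b
  weight-cong {S = S} {S′} {a} {b} S≗S′ a≗b = activityWeight-cong
    {int = internallyActive S a} {internallyActive S′ b} {externallyActive S a} {externallyActive S′ b}
    (λ i → unmovable-cong (λ j → S≗S′ (moveOut-cong i j a≗b)) i)
    (λ i → unmovable-cong (λ j → S≗S′ (moveIn-cong i j a≗b)) i)

  -- A sum over the whole box with a membership test gives all slices the same index list, so that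
  -- sums over p and q can be interchanged and translated; empty slices contribute 0.
  total : ∀ {n} → (Vect n → Bool) → Carrier
  total S = ∑ (allVecs _ xs) (λ v → weight S x y v when S v)

  total-cong : ∀ {n} {S S′ : Vect n → Bool} → MConvex S → (∀ v → S v ≡ S′ v) → total S ≈ total S′
  total-cong C S≗S′ = ∑-cong (allVecs _ xs) λ {v} _ → reflexive (cong₂ _when_
    (weight-cong {a = v} (λ {_} {d} c≗d → ≡.trans (resp C c≗d) (S≗S′ d)) (λ _ → ≡.refl)) (S≗S′ v))

  total-empty : ∀ {n} {S : Vect n → Bool} → (∀ v → S v ≡ false) → total S ≈ 0#
  total-empty {S = S} empty = ∑-zero (allVecs _ xs) λ {v} _ → reflexive (cong (weight S x y v when_) (empty v))

  occupied : ∀ {n} → (Vect (suc n) → Bool) → Fin (suc n) → ℤ → Bool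
  occupied S t p = inhabited (slice S t p)

  module _ {n} {S : Vect (suc n) → Bool} (C : MConvex S) where

    occupied⁺ : ∀ {t p a} → S a ≡ true → a t ≡ p → occupied S t p ≡ true
    occupied⁺ {t} {p} Sa at = ∃⇒inhabited (slice-MConvex C t p)
      (resp-true C (≡.sym ∘ insertAt-unique t at (λ _ → ≡.refl)) Sa)

    occupied⁻ : ∀ {t p} → occupied S t p ≡ true → ∃ λ a → S a ≡ true × a t ≡ p
    occupied⁻ {t} {p} occ with inhabited⇒∃ (slice S t p) occ
    ... | v , Sv = insertAt t p v , Sv , insertAt-hit t p v

    private
      last : Fin (suc n)
      last = fromℕ n

    module _ {p v} (Sa : S (insertAt last p v) ≡ true) where

      private
        a : Vect (suc n)
        a = insertAt last p v

        a-last : a last ≡ p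
        a-last = insertAt-hit last p v

        last≢ : ∀ {k} → last ≢ punchIn last k
        last≢ = Finₚ.punchInᵢ≢i last _ ∘ ≡.sym

      -- A move that lowers the last coordinate reaches the value p - 1; conversely, exchange of a
      -- with any point having that value yields such a move of a itself. No minimum has to be
      -- computed.
      internallyActive-last : internallyActive S a last ≡ not (occupied S last (p ℤ.- 1ℤ))
      internallyActive-last = unmovable-last (λ j → S (moveOut a last j)) _
        (λ k Sb → occupied⁺ Sb (≡.trans (moveOut-source a last≢) (cong (ℤ._- 1ℤ) a-last)))
        movable
        where
        movable : occupied S last (p ℤ.- 1ℤ) ≡ true → ∃ λ k → S (moveOut a last (punchIn last k)) ≡ true
        movable occ with occupied⁻ occ
        ... | b , Sb , b-last with lower C last Sa Sb (subst₂ _<_ (≡.sym b-last) (≡.sym a-last) (p-1<p p))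
        ... | j , a<b , Sc with position last j
        ... | hit = contradiction (subst₂ _<_ a-last b-last a<b) (ℤₚ.<-asym (p-1<p p))
        ... | miss k = k , Sc

      externallyActive-last : externallyActive S a last ≡ not (occupied S last (p ℤ.+ 1ℤ))
      externallyActive-last = unmovable-last (λ j → S (moveIn a last j)) _
        (λ k Sb → occupied⁺ Sb (≡.trans (moveIn≗moveOut a last (punchIn last k) last)
          (≡.trans (moveOut-target a (last≢ ∘ ≡.sym)) (cong (ℤ._+ 1ℤ) a-last))))
        movable
        where
        movable : occupied S last (p ℤ.+ 1ℤ) ≡ true → ∃ λ k → S (moveIn a last (punchIn last k)) ≡ true
        movable occ with occupied⁻ occ
        ... | b , Sb , b-last with raise C last Sa Sb (subst₂ _<_ (≡.sym a-last) (≡.sym b-last) (p<p+1 p))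
        ... | j , b<a , Sc with position last j
        ... | hit = contradiction (subst₂ _<_ b-last a-last b<a) (ℤₚ.<-asym (p<p+1 p))
        ... | miss k = k , resp-true C (≡.sym ∘ moveIn≗moveOut a last (punchIn last k)) Sc

      weight-last : weight S x y a ≈
        activity (not (occupied S last (p ℤ.- 1ℤ))) (not (occupied S last (p ℤ.+ 1ℤ))) * weight (slice S last p) x y v
      weight-last = trans (activityWeight-punchIn last (internallyActive S a) (externallyActive S a))
        (*-cong (reflexive (cong₂ activity internallyActive-last externallyActive-last))
                (reflexive (activityWeight-cong
                  {int = internallyActive S a ∘ punchIn last} {internallyActive (slice S last p) v}
                  {externallyActive S a ∘ punchIn last} {externallyActive (slice S last p) v}
                  internallyActive-rest externallyActive-rest)))
        where
        internallyActive-rest : ∀ i → internallyActive S a (punchIn last i) ≡ internallyActive (slice S last p) v i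
        internallyActive-rest i = ≡.trans (unmovable-rest (λ j → S (moveOut a (punchIn last i) j)) i)
          (unmovable-cong (λ j → resp C (≡.sym ∘ insertAt-moveOut last p v i j)) i)

        externallyActive-rest : ∀ i → externallyActive S a (punchIn last i) ≡ externallyActive (slice S last p) v i
        externallyActive-rest i = ≡.trans (unmovable-rest (λ j → S (moveIn a (punchIn last i) j)) i)
          (unmovable-cong (λ j → resp C (≡.sym ∘ insertAt-moveIn last p v i j)) i)

  -- On nonempty slices this is x at the lowest value of coordinate t, y at the highest, 1 in
  -- between, and x + y - 1 if there is only one value. The theorem excludes the last case for P,
  -- but slices met in the induction may be constant in t.
  sliceFactor : ∀ {n} → (Vect (suc n) → Bool) → Fin (suc n) → ℤ → Carrier
  sliceFactor S t p = activity (not (occupied S t (p ℤ.- 1ℤ))) (not (occupied S t (p ℤ.+ 1ℤ)))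

  sliceSum : ∀ {n} → (Vect (suc n) → Bool) → Fin (suc n) → Carrier
  sliceSum S t = ∑ xs (λ p → sliceFactor S t p * total (slice S t p))

  *-when : ∀ k a b → (k * a) when b ≈ k * (a when b)
  *-when k a true = refl
  *-when k a false = sym (zeroʳ k)

  total-last : ∀ {n} {S : Vect (suc n) → Bool} → MConvex S → total S ≈ sliceSum S (fromℕ n)
  total-last {n} {S} C = begin
    total S
      ≈⟨ ∑-insertAt xs L (λ a≗b → reflexive (cong₂ _when_ (weight-cong (resp C) a≗b) (resp C a≗b))) ⟩
    ∑ xs (λ p → ∑ (allVecs n xs) (λ v → weight S x y (insertAt L p v) when slice S L p v))
      ≈⟨ ∑-cong xs (λ {p} _ → ∑-cong (allVecs n xs) λ {v} _ →
           trans (when-cong (slice S L p v) (weight-last C)) (*-when _ _ (slice S L p v))) ⟩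
    ∑ xs (λ p → ∑ (allVecs n xs) (λ v → sliceFactor S L p * (weight (slice S L p) x y v when slice S L p v)))
      ≈⟨ ∑-cong xs (λ {p} _ → ∑-*ˡ (sliceFactor S L p) (allVecs n xs) _) ⟩
    sliceSum S L ∎
    where L = fromℕ n

  -- With x = 1 + X and y = 1 + Y all activity factors are linear in X and Y. The
  -- Booleans e n l w s r record which of the neighbours (p+1,q), (p,q+1), (p-1,q+1),
  -- (p-1,q), (p,q-1), (p+1,q-1) of a point (p,q) ∈ Q lie in Q. The difference of
  -- its two weights is Y(1+Y)([¬n∧l] - [¬e∧r]) - X(1+X)([¬w∧l] - [¬s∧r]), here
  -- with all terms moved to where they are positive.

  X Y : Carrier
  X = x + (- 1#)
  Y = y + (- 1#)

  linear : Bool → Bool → Carrier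
  linear i e = 1# + X when i + Y when e

  1+X≈x : ∀ x → 1# + (x + (- 1#)) ≈ x
  1+X≈x x = trans (+-comm 1# _) (trans (+-assoc x _ _) (trans (+-congˡ (-‿inverseˡ 1#)) (+-identityʳ x)))

  activity≈linear : ∀ i e → activity i e ≈ linear i e
  activity≈linear true true = sym (trans (+-congʳ (1+X≈x x)) (sym (+-assoc x y _)))
  activity≈linear true false = sym (trans (+-identityʳ _) (1+X≈x x))
  activity≈linear false true = sym (trans (+-congʳ (+-identityʳ 1#)) (1+X≈x y))
  activity≈linear false false = sym (trans (+-identityʳ _) (+-identityʳ _))

  module _ where
    open import Algebra.Solver.Ring.NaturalCoefficients.Default commutativeSemiring
      using (solve; _:=_; Polynomial; con; _:+_; _:*_)

    hexagon-equation : (e n l w s r : Bool) → Polynomial 2 → Polynomial 2 → Polynomial 2 × Polynomial 2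
    hexagon-equation e n l w s r X Y =
      (lin (not (w ∨ l)) (not (e ∨ r)) :* lin (not s) (not n)
        :+ X :* (con 1 :+ X) if (not w ∧ l) :+ Y :* (con 1 :+ Y) if (not e ∧ r))
      := (lin (not (s ∨ r)) (not (n ∨ l)) :* lin (not w) (not e)
        :+ X :* (con 1 :+ X) if (not s ∧ r) :+ Y :* (con 1 :+ Y) if (not n ∧ l))
      where
      infixl 8 _if_
      _if_ : Polynomial 2 → Bool → Polynomial 2
      P if b = if b then P else con 0

      lin : Bool → Bool → Polynomial 2
      lin i e = con 1 :+ X if i :+ Y if e

    -- The case with l true and r false. The three implications leave eight of the sixteen
    -- neighbourhoods; in each, the Booleans being concrete, the claim is a polynomial identity in X
    -- and Y.
    hexagon-northwest : ∀ e n w s → (e ≡ true → n ≡ true) → (s ≡ true → w ≡ true) → (e ≡ true → s ≡ false) →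
      linear (not (w ∨ true)) (not (e ∨ false)) * linear (not s) (not n)
        + X * (1# + X) when (not w ∧ true) + Y * (1# + Y) when (not e ∧ false) ≈
      linear (not (s ∨ false)) (not (n ∨ true)) * linear (not w) (not e)
        + X * (1# + X) when (not s ∧ false) + Y * (1# + Y) when (not n ∧ true)
    hexagon-northwest true true true false _ _ _ = solve 2 (hexagon-equation true true true true false false) refl X Y
    hexagon-northwest true true false false _ _ _ = solve 2 (hexagon-equation true true true false false false) refl X Y
    hexagon-northwest false true true true _ _ _ = solve 2 (hexagon-equation false true true true true false) refl X Y
    hexagon-northwest false true true false _ _ _ = solve 2 (hexagon-equation false true true true false false) refl X Y
    hexagon-northwest false true false false _ _ _ = solve 2 (hexagon-equation false true true false false false) refl X Y
    hexagon-northwest false false true true _ _ _ = solve 2 (hexagon-equation false false true true true false) refl X Y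
    hexagon-northwest false false true false _ _ _ = solve 2 (hexagon-equation false false true true false false) refl X Y
    hexagon-northwest false false false false _ _ _ = solve 2 (hexagon-equation false false true false false false) refl X Y
    hexagon-northwest true false _ _ e⇒n _ _ = contradiction (e⇒n ≡.refl) λ ()
    hexagon-northwest _ _ false true _ s⇒w _ = contradiction (s⇒w ≡.refl) λ ()
    hexagon-northwest true _ _ true _ _ e⇒¬s = contradiction (e⇒¬s ≡.refl) λ ()

  -- If l and r both hold, then e = n and w = s, and the two sides coincide. If neither holds, the
  -- correction terms vanish and the two factors commute. The mixed cases are mirror images under e
  -- ↔ n, w ↔ s, l ↔ r.
  hexagon-linear : ∀ e n l w s r →
    (e ≡ true → l ≡ true → n ≡ true) → (n ≡ true → r ≡ true → e ≡ true) →
    (w ≡ true → r ≡ true → s ≡ true) → (s ≡ true → l ≡ true → w ≡ true) →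
    (n ≡ true → w ≡ true → l ≡ true) → (e ≡ true → s ≡ true → r ≡ true) →
    linear (not (w ∨ l)) (not (e ∨ r)) * linear (not s) (not n)
      + X * (1# + X) when (not w ∧ l) + Y * (1# + Y) when (not e ∧ r) ≈
    linear (not (s ∨ r)) (not (n ∨ l)) * linear (not w) (not e)
      + X * (1# + X) when (not s ∧ r) + Y * (1# + Y) when (not n ∧ l)
  hexagon-linear e n true w s true el⇒n nr⇒e wr⇒s sl⇒w _ _
    with iff⇒≡ (λ e → el⇒n e ≡.refl) (λ n → nr⇒e n ≡.refl) | iff⇒≡ (λ w → wr⇒s w ≡.refl) (λ s → sl⇒w s ≡.refl)
  ... | ≡.refl | ≡.refl = refl
  hexagon-linear e n true w s false el⇒n _ _ sl⇒w _ es⇒r = hexagon-northwest e n w s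
    (λ e → el⇒n e ≡.refl) (λ s → sl⇒w s ≡.refl) (λ e → ¬-not λ s → contradiction (es⇒r e s) λ ())
  hexagon-linear e n false w s true _ nr⇒e wr⇒s _ nw⇒l _ = sym (hexagon-northwest n e s w
    (λ n → nr⇒e n ≡.refl) (λ w → wr⇒s w ≡.refl) (λ n → ¬-not λ w → contradiction (nw⇒l n w) λ ()))
  hexagon-linear e n false w s false _ _ _ _ _ _
    rewrite Boolₚ.∨-identityʳ e | Boolₚ.∨-identityʳ n | Boolₚ.∨-identityʳ w | Boolₚ.∨-identityʳ s
          | Boolₚ.∧-zeroʳ (not e) | Boolₚ.∧-zeroʳ (not n) | Boolₚ.∧-zeroʳ (not w) | Boolₚ.∧-zeroʳ (not s)
    = +-congʳ (+-congʳ (*-comm _ _))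

  open import Algebra.Properties.Ring ring using (+-cancelʳ)

  ∑² : (ℤ → ℤ → Carrier) → Carrier
  ∑² F = ∑ xs (λ p → ∑ xs (λ q → F p q))

  ∑²-cong : ∀ {F G} → (∀ p q → F p q ≈ G p q) → ∑² F ≈ ∑² G
  ∑²-cong F≈G = ∑-cong xs λ {p} _ → ∑-cong xs λ {q} _ → F≈G p q

  ∑²-+ : ∀ F G → ∑² (λ p q → F p q + G p q) ≈ ∑² F + ∑² G
  ∑²-+ F G = trans (∑-cong xs λ {p} _ → ∑-+ xs (F p) (G p))
    (∑-+ xs (λ p → ∑ xs (F p)) (λ p → ∑ xs (G p)))

  -- The four memberships say that (p,q) and (p-1,q+1) both lie in the box. So F vanishes on every
  -- boundary line that the translation by (1,-1) drops or adds.
  ∑²-shift : ∀ F →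
    (∀ p q → ¬ (p ∈ xs × p ℤ.- 1ℤ ∈ xs × q ∈ xs × q ℤ.+ 1ℤ ∈ xs) → F p q ≈ 0#) →
    ∑² F ≈ ∑² (λ p q → F (p ℤ.+ 1ℤ) (q ℤ.- 1ℤ))
  ∑²-shift F vanish = begin
    ∑² F
      ≈⟨ ∑-range-shift lo N
           (∑-zero xs λ {q} _ → vanish lo q λ (_ , lo-1∈ , _) → lo-1∉ lo-1∈)
           (∑-zero xs λ {q} _ → vanish (lo ℤ.+ + N) q λ (hi∈ , _) → hi∉ hi∈) ⟩
    ∑² (λ p q → F (p ℤ.+ 1ℤ) q)
      ≈⟨ ∑²-cong (λ p q → reflexive (cong (F (p ℤ.+ 1ℤ)) (≡.sym (p+1-1 q)))) ⟩
    ∑² (λ p q → F (p ℤ.+ 1ℤ) (q ℤ.+ 1ℤ ℤ.- 1ℤ))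
      ≈⟨ ∑-cong xs (λ {p} _ → ∑-range-shift lo N {λ q → F (p ℤ.+ 1ℤ) (q ℤ.- 1ℤ)}
           (vanish _ _ λ (_ , _ , lo-1∈ , _) → lo-1∉ lo-1∈)
           (vanish _ _ λ (_ , _ , _ , hi∈) → hi∉ (subst (_∈ xs) (p-1+1 (lo ℤ.+ + N)) hi∈))) ⟨
    ∑² (λ p q → F (p ℤ.+ 1ℤ) (q ℤ.- 1ℤ)) ∎
    where
    lo-1∉ : ¬ (lo ℤ.- 1ℤ ∈ xs)
    lo-1∉ lo-1∈ = ℤₚ.≤⇒≯ (∈-range⇒≥ lo N lo-1∈) (p-1<p lo)

    hi∉ : ¬ (lo ℤ.+ + N ∈ xs)
    hi∉ hi∈ = ℤₚ.<-irrefl ≡.refl (∈-range⇒< lo N hi∈)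

  inhabited-cong : ∀ {n} {S S′ : Vect n → Bool} → MConvex S → MConvex S′ → (∀ v → S v ≡ S′ v) →
    inhabited S ≡ inhabited S′
  inhabited-cong {S = S} {S′} C C′ S≗S′ = iff⇒≡
    (λ occ → let (v , Sv) = inhabited⇒∃ S occ in ∃⇒inhabited C′ (≡.trans (≡.sym (S≗S′ v)) Sv))
    (λ occ → let (v , Sv) = inhabited⇒∃ S′ occ in ∃⇒inhabited C (≡.trans (S≗S′ v) Sv))

  -- The two orders of slicing, compared over the projection Q.

  module LastAndOther {m} {S : Vect (suc (suc m)) → Bool} (C : MConvex S) (t : Fin (suc m)) where
    open Planar C

    L : Fin (suc (suc m))
    L = fromℕ (suc m)

    u : Fin (suc (suc m))
    u = punchIn L t

    L≢u : L ≢ u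
    L≢u = Finₚ.punchInᵢ≢i L t ∘ ≡.sym

    u≢L : u ≢ L
    u≢L = L≢u ∘ ≡.sym

    fiber : ℤ → ℤ → Vect m → Bool
    fiber p q = slice (slice S L p) t q

    fiber-MConvex : ∀ p q → MConvex (fiber p q)
    fiber-MConvex p q = slice-MConvex (slice-MConvex C L p) t q

    Q : ℤ → ℤ → Bool
    Q p q = inhabited (fiber p q)

    U : ℤ → ℤ → Carrier
    U p q = total (fiber p q)

    pair : ℤ → ℤ → Vect m → Vect (suc (suc m))
    pair p q v = insertAt L p (insertAt t q v)

    pair-L : ∀ p q v → pair p q v L ≡ p
    pair-L p q v = insertAt-hit L p (insertAt t q v)

    pair-u : ∀ p q v → pair p q v u ≡ q
    pair-u p q v = ≡.trans (insertAt-miss L p (insertAt t q v) t) (insertAt-hit t q v)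

    pair-rest : ∀ p q v k → pair p q v (punchIn L (punchIn t k)) ≡ v k
    pair-rest p q v k = ≡.trans (insertAt-miss L p (insertAt t q v) (punchIn t k)) (insertAt-miss t q v k)

    pair-unique : ∀ {p q v c} → c L ≡ p → c u ≡ q → (∀ k → c (punchIn L (punchIn t k)) ≡ v k) → pair p q v ≗ c
    pair-unique cL cu cv = insertAt-unique L cL (≡.sym ∘ insertAt-unique t cu cv)

    Q⁻ : ∀ {p q} → Q p q ≡ true → At L u p q
    Q⁻ {p} {q} occ with inhabited⇒∃ (fiber p q) occ
    ... | v , Sv = pair p q v , Sv , pair-L p q v , pair-u p q v

    Q⁺ : ∀ {p q} → At L u p q → Q p q ≡ true
    Q⁺ {p} {q} (a , Sa , aL , au) = ∃⇒inhabited (fiber-MConvex p q)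
      {λ k → a (punchIn L (punchIn t k))} (resp-true C (≡.sym ∘ pair-unique aL au (λ _ → ≡.refl)) Sa)

    ¬Q⁻ : ∀ {p q} → Q p q ≡ false → ¬ At L u p q
    ¬Q⁻ none at = contradiction (≡.trans (≡.sym (Q⁺ at)) none) λ ()

    U-empty : ∀ {p q} → Q p q ≡ false → U p q ≈ 0#
    U-empty {p} {q} none = total-empty (¬inhabited⇒¬∃ (fiber-MConvex p q) none)

    module _ {p q : ℤ} where

      pair-southeast : ∀ v → moveOut (pair p q v) u L ≗ pair (p ℤ.+ 1ℤ) (q ℤ.- 1ℤ) v
      pair-southeast v = ≡.sym ∘ pair-unique
        (≡.trans (moveOut-target a u≢L) (cong (ℤ._+ 1ℤ) (pair-L p q v)))
        (≡.trans (moveOut-source a u≢L) (cong (ℤ._- 1ℤ) (pair-u p q v)))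
        (λ k → ≡.trans (moveOut-other a (Finₚ.punchInᵢ≢i t k ∘ Finₚ.punchIn-injective L _ _) (Finₚ.punchInᵢ≢i L _))
                       (pair-rest p q v k))
        where a = pair p q v

      pair-northwest : ∀ v → moveOut (pair (p ℤ.+ 1ℤ) (q ℤ.- 1ℤ) v) L u ≗ pair p q v
      pair-northwest v = ≡.sym ∘ pair-unique
        (≡.trans (moveOut-source b L≢u) (≡.trans (cong (ℤ._- 1ℤ) (pair-L _ _ v)) (p+1-1 p)))
        (≡.trans (moveOut-target b L≢u) (≡.trans (cong (ℤ._+ 1ℤ) (pair-u (p ℤ.+ 1ℤ) _ v)) (p-1+1 q)))
        (λ k → ≡.trans (moveOut-other b (Finₚ.punchInᵢ≢i L _) (Finₚ.punchInᵢ≢i t k ∘ Finₚ.punchIn-injective L _ _))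
                       (pair-rest (p ℤ.+ 1ℤ) _ v k))
        where b = pair (p ℤ.+ 1ℤ) (q ℤ.- 1ℤ) v

      -- On an extreme diagonal of the projection all fibers coincide.
      U-southeast : Q p q ≡ true → Q (p ℤ.+ 1ℤ) (q ℤ.- 1ℤ) ≡ true →
        (Q (p ℤ.+ 1ℤ) q ≡ false) ⊎ (Q p (q ℤ.- 1ℤ) ≡ false) → U (p ℤ.+ 1ℤ) (q ℤ.- 1ℤ) ≈ U p q
      U-southeast Qpq QR extreme = total-cong (fiber-MConvex _ _) λ v → iff⇒≡ (forth v) (back v)
        where
        forth : ∀ v → fiber (p ℤ.+ 1ℤ) (q ℤ.- 1ℤ) v ≡ true → fiber p q v ≡ true
        -- Any point over (p,q) serves as target of the exchange: it fixes the direction of the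
        -- move, while the coordinates v are kept.
        forth v Sb with Q⁻ Qpq
        ... | a , Sa , aL , au = resp-true C (pair-northwest v) (move extreme)
          where
          move : _ → S (moveOut (pair (p ℤ.+ 1ℤ) (q ℤ.- 1ℤ) v) L u) ≡ true
          move (inj₁ ¬E) = ¬east⇒northwest L≢u Sa Sb aL au (pair-L _ _ v) (pair-u (p ℤ.+ 1ℤ) _ v) (¬Q⁻ ¬E)
          move (inj₂ ¬So) = ¬south⇒northwest L≢u Sa Sb aL au (pair-L _ _ v) (pair-u (p ℤ.+ 1ℤ) _ v) (¬Q⁻ ¬So)

        back : ∀ v → fiber p q v ≡ true → fiber (p ℤ.+ 1ℤ) (q ℤ.- 1ℤ) v ≡ true
        back v Sa with Q⁻ QR
        ... | b , Sb , bL , bu = resp-true C (pair-southeast v) (move extreme)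
          where
          move : _ → S (moveOut (pair p q v) u L) ≡ true
          move (inj₁ ¬E) = ¬east⇒southeast L≢u Sa Sb (pair-L p q v) (pair-u p q v) bL bu (¬Q⁻ ¬E)
          move (inj₂ ¬So) = ¬south⇒southeast L≢u Sa Sb (pair-L p q v) (pair-u p q v) bL bu (¬Q⁻ ¬So)

    Q-boxed : ∀ {p q} → Q p q ≡ true → p ∈ xs × q ∈ xs
    Q-boxed occ with Q⁻ occ
    ... | a , Sa , ≡.refl , ≡.refl = boxed C Sa L , boxed C Sa u

    -- Both sides run over pairs of neighbours (p,q), (p+1,q-1) on an extreme diagonal. The left
    -- side charges a pair to its southeast member and the right side to its northwest one; the
    -- translation matches them because the fibres over the two members coincide.
    diagonal-shift : ∀ k (c d : ℤ → ℤ → Bool) →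
      (∀ p q → c (p ℤ.+ 1ℤ) (q ℤ.- 1ℤ) ≡ d p q) →
      (∀ {p q} → d p q ≡ false → (Q (p ℤ.+ 1ℤ) q ≡ false) ⊎ (Q p (q ℤ.- 1ℤ) ≡ false)) →
      ∑² (λ p q → k when (not (c p q) ∧ Q (p ℤ.- 1ℤ) (q ℤ.+ 1ℤ)) * U p q) ≈
      ∑² (λ p q → k when (not (d p q) ∧ Q (p ℤ.+ 1ℤ) (q ℤ.- 1ℤ)) * U p q)
    diagonal-shift k c d c≡d extreme = trans (∑²-shift F vanish) (∑²-cong shifted)
      where
      F : ℤ → ℤ → Carrier
      F p q = k when (not (c p q) ∧ Q (p ℤ.- 1ℤ) (q ℤ.+ 1ℤ)) * U p q

      when-false : ∀ b w → k when (not b ∧ false) * w ≈ 0#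
      when-false b w = trans (*-congʳ (reflexive (cong (k when_) (Boolₚ.∧-zeroʳ (not b))))) (zeroˡ w)

      vanish : ∀ p q → ¬ (p ∈ xs × p ℤ.- 1ℤ ∈ xs × q ∈ xs × q ℤ.+ 1ℤ ∈ xs) → F p q ≈ 0#
      vanish p q outside with Q p q in Qpq | Q (p ℤ.- 1ℤ) (q ℤ.+ 1ℤ) in QL
      ... | false | _ = trans (*-congˡ (U-empty Qpq)) (zeroʳ _)
      ... | true | false = when-false (c p q) (U p q)
      ... | true | true with Q-boxed Qpq | Q-boxed QL
      ... | p∈ , q∈ | p-1∈ , q+1∈ = contradiction (p∈ , p-1∈ , q∈ , q+1∈) outside

      shifted : ∀ p q → F (p ℤ.+ 1ℤ) (q ℤ.- 1ℤ) ≈ k when (not (d p q) ∧ Q (p ℤ.+ 1ℤ) (q ℤ.- 1ℤ)) * U p q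
      shifted p q rewrite c≡d p q | p+1-1 p | p-1+1 q
        with Q p q in Qpq | Q (p ℤ.+ 1ℤ) (q ℤ.- 1ℤ) in QR | d p q in dpq
      ... | false | _     | b     = trans (when-false b _) (sym (trans (*-congˡ (U-empty Qpq)) (zeroʳ _)))
      ... | true  | false | b     = trans (trans (*-congˡ (U-empty QR)) (zeroʳ _)) (sym (when-false b _))
      ... | true  | true  | true  = trans (zeroˡ _) (sym (zeroˡ _))
      ... | true  | true  | false = *-congˡ (U-southeast Qpq QR (extreme dpq))

    -- The same index as `u`, in the form that suits slicing by t first; `punchIn-fromℕ` identifies
    -- the two.
    u′ : Fin (suc (suc m))
    u′ = inject₁ t

    row col : ℤ → ℤ → Carrier
    row p q = sliceFactor S L p * sliceFactor (slice S L p) t q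
    col p q = sliceFactor S u′ q * sliceFactor (slice S u′ q) (fromℕ m) p

    fiber-comm : ∀ p q v → fiber p q v ≡ slice (slice S u′ q) (fromℕ m) p v
    fiber-comm p q v = resp C (insertAt-last-comm t p q v)

    ∨-elim : ∀ {b c} → b ∨ c ≡ true → (b ≡ true) ⊎ (c ≡ true)
    ∨-elim {true} _ = inj₁ ≡.refl
    ∨-elim {false} c = inj₂ c

    ∨-intro : ∀ {b c} → (b ≡ true) ⊎ (c ≡ true) → b ∨ c ≡ true
    ∨-intro (inj₁ ≡.refl) = ≡.refl
    ∨-intro {b} (inj₂ ≡.refl) = Boolₚ.∨-zeroʳ b

    occupied-cases : ∀ {t p b c} {A B : Set} → (occupied S t p ≡ true → A ⊎ B) →
      (b ≡ true → ∃ λ a → S a ≡ true × a t ≡ p) → (c ≡ true → ∃ λ a → S a ≡ true × a t ≡ p) →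
      (A → b ≡ true) → (B → c ≡ true) → occupied S t p ≡ b ∨ c
    occupied-cases {t} {p} {b} {c} split b⇒ c⇒ A⇒b B⇒c = iff⇒≡
      (λ occ → ∨-intro (Sum.map A⇒b B⇒c (split occ)))
      (λ b∨c → found (Sum.[ b⇒ , c⇒ ]′ (∨-elim {b} b∨c)))
      where
      found : (∃ λ a → S a ≡ true × a t ≡ p) → occupied S t p ≡ true
      found (_ , Sa , at) = occupied⁺ C Sa at

    module _ {p q : ℤ} (Qpq : Q p q ≡ true) where

      private
        east north-of northwest-of west south-of southeast : Bool
        east         = Q (p ℤ.+ 1ℤ) q
        north-of     = Q p (q ℤ.+ 1ℤ)
        northwest-of = Q (p ℤ.- 1ℤ) (q ℤ.+ 1ℤ)
        west         = Q (p ℤ.- 1ℤ) q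
        south-of     = Q p (q ℤ.- 1ℤ)
        southeast    = Q (p ℤ.+ 1ℤ) (q ℤ.- 1ℤ)

        fst : ∀ {p q} → Q p q ≡ true → ∃ λ a → S a ≡ true × a L ≡ p
        fst occ = let (a , Sa , aL , _) = Q⁻ occ in a , Sa , aL

        snd : ∀ {p q} → Q p q ≡ true → ∃ λ a → S a ≡ true × a u ≡ q
        snd occ = let (a , Sa , _ , au) = Q⁻ occ in a , Sa , au

      -- The first factor asks which values of the last coordinate occur in all of S, and `down` and
      -- `up` answer this by neighbours of (p,q). The second factor already speaks of neighbours
      -- with the same p, by definition of Q.
      row≡ : row p q ≡ activity (not (west ∨ northwest-of)) (not (east ∨ southeast))
                       * activity (not south-of) (not north-of)
      row≡ = cong (_* activity (not south-of) (not north-of)) (cong₂ (λ b c → activity (not b) (not c))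
        (occupied-cases (down L≢u (Q⁻ Qpq) ∘ occupied⁻ C) fst fst Q⁺ Q⁺)
        (occupied-cases (up L≢u (Q⁻ Qpq) ∘ occupied⁻ C) fst fst Q⁺ Q⁺))

      col≡ : col p q ≡ activity (not (south-of ∨ southeast)) (not (north-of ∨ northwest-of))
                       * activity (not west) (not east)
      col≡ = cong₂ _*_
        (≡.trans (cong (λ w → sliceFactor S w q) (≡.sym (punchIn-fromℕ t)))
          (cong₂ (λ b c → activity (not b) (not c))
            (occupied-cases (down u≢L (swap (Q⁻ Qpq)) ∘ occupied⁻ C) snd snd (Q⁺ ∘ swap) (Q⁺ ∘ swap))
            (occupied-cases (up u≢L (swap (Q⁻ Qpq)) ∘ occupied⁻ C) snd snd (Q⁺ ∘ swap) (Q⁺ ∘ swap))))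
        (cong₂ (λ b c → activity (not b) (not c)) (occ≡ (p ℤ.- 1ℤ)) (occ≡ (p ℤ.+ 1ℤ)))
        where
        occ≡ : ∀ p → occupied (slice S u′ q) (fromℕ m) p ≡ Q p q
        occ≡ p = ≡.sym (inhabited-cong (fiber-MConvex p q)
          (slice-MConvex (slice-MConvex C u′ q) (fromℕ m) p) (fiber-comm p q))

      hexagon :
        row p q + (X * (1# + X)) when (not west ∧ northwest-of) + (Y * (1# + Y)) when (not east ∧ southeast) ≈
        col p q + (X * (1# + X)) when (not south-of ∧ southeast) + (Y * (1# + Y)) when (not north-of ∧ northwest-of)
      hexagon = begin
        row p q + _ + _
          ≈⟨ +-congʳ (+-congʳ (trans (reflexive row≡) (*-cong (activity≈linear _ _) (activity≈linear _ _)))) ⟩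
        linear (not (west ∨ northwest-of)) (not (east ∨ southeast)) * linear (not south-of) (not north-of) + _ + _
          ≈⟨ hexagon-linear east north-of northwest-of west south-of southeast
               (λ e l → Q⁺ (north L≢u (Q⁻ e) (Q⁻ l)))
               (λ n r → Q⁺ (swap (north u≢L (swap (Q⁻ n)) (swap (Q⁻ r)))))
               (λ w r → Q⁺ (south L≢u (Q⁻ w) (Q⁻ r)))
               (λ s l → Q⁺ (swap (south u≢L (swap (Q⁻ s)) (swap (Q⁻ l)))))
               (λ n w → Q⁺ (northwest L≢u (Q⁻ n) (Q⁻ w)))
               (λ e s → Q⁺ (swap (northwest u≢L (swap (Q⁻ e)) (swap (Q⁻ s))))) ⟩
        linear (not (south-of ∨ southeast)) (not (north-of ∨ northwest-of)) * linear (not west) (not east) + _ + _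
          ≈⟨ +-congʳ (+-congʳ (trans (reflexive col≡) (*-cong (activity≈linear _ _) (activity≈linear _ _)))) ⟨
        col p q + _ + _ ∎

    row-col : ∑² (λ p q → row p q * U p q) ≈ ∑² (λ p q → col p q * U p q)
    row-col = +-cancelʳ _ _ _ (+-cancelʳ _ _ _ (begin
      ∑² (λ p q → row p q * U p q) + ∑² XL + ∑² YR
        ≈⟨ ∑²-+₃ _ _ _ ⟨
      ∑² (λ p q → row p q * U p q + XL p q + YR p q)
        ≈⟨ ∑²-cong local ⟩
      ∑² (λ p q → col p q * U p q + XR p q + YL p q)
        ≈⟨ ∑²-+₃ _ _ _ ⟩
      ∑² (λ p q → col p q * U p q) + ∑² XR + ∑² YL
        -- The X terms live where (p,q-1) is missing, on the diagonal of minimal p + q; the Y terms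
        -- where (p+1,q) is missing, on that of maximal p + q. Both pairs of sums match by
        -- translation and cancel.
        ≈⟨ +-cong (+-congˡ (diagonal-shift (X * (1# + X)) (λ p q → Q (p ℤ.- 1ℤ) q) (λ p q → Q p (q ℤ.- 1ℤ))
                              (λ p q → cong (λ p → Q p (q ℤ.- 1ℤ)) (p+1-1 p)) inj₂))
                  (sym (diagonal-shift (Y * (1# + Y)) (λ p q → Q p (q ℤ.+ 1ℤ)) (λ p q → Q (p ℤ.+ 1ℤ) q)
                              (λ p q → cong (Q (p ℤ.+ 1ℤ)) (p-1+1 q)) inj₁)) ⟨
      ∑² (λ p q → col p q * U p q) + ∑² XL + ∑² YR ∎))
      where
      XL XR YL YR : ℤ → ℤ → Carrier
      XL p q = (X * (1# + X)) when (not (Q (p ℤ.- 1ℤ) q) ∧ Q (p ℤ.- 1ℤ) (q ℤ.+ 1ℤ)) * U p q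
      XR p q = (X * (1# + X)) when (not (Q p (q ℤ.- 1ℤ)) ∧ Q (p ℤ.+ 1ℤ) (q ℤ.- 1ℤ)) * U p q
      YL p q = (Y * (1# + Y)) when (not (Q p (q ℤ.+ 1ℤ)) ∧ Q (p ℤ.- 1ℤ) (q ℤ.+ 1ℤ)) * U p q
      YR p q = (Y * (1# + Y)) when (not (Q (p ℤ.+ 1ℤ) q) ∧ Q (p ℤ.+ 1ℤ) (q ℤ.- 1ℤ)) * U p q

      ∑²-+₃ : ∀ F G H → ∑² (λ p q → F p q + G p q + H p q) ≈ ∑² F + ∑² G + ∑² H
      ∑²-+₃ F G H = trans (∑²-+ (λ p q → F p q + G p q) H) (+-congʳ (∑²-+ F G))

      distrib₃ : ∀ a b c d → (a + b + c) * d ≈ a * d + b * d + c * d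
      distrib₃ a b c d = trans (distribʳ d (a + b) c) (+-congʳ (distribʳ d a b))

      local : ∀ p q → row p q * U p q + XL p q + YR p q ≈ col p q * U p q + XR p q + YL p q
      local p q = trans (sym (distrib₃ _ _ _ _)) (trans scaled (distrib₃ _ _ _ _))
        where
        scaled : (row p q + (X * (1# + X)) when _ + (Y * (1# + Y)) when _) * U p q ≈
                 (col p q + (X * (1# + X)) when _ + (Y * (1# + Y)) when _) * U p q
        scaled with Q p q in Qpq
        ... | true = *-congʳ (hexagon Qpq)
        ... | false = trans (trans (*-congˡ (U-empty Qpq)) (zeroʳ _)) (sym (trans (*-congˡ (U-empty Qpq)) (zeroʳ _)))

  total-slices : ∀ {n} {S : Vect (suc n) → Bool} → MConvex S → ∀ t → total S ≈ sliceSum S t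
  total-slices {n} {S} C t with view t
  ... | ‵fromℕ = total-last C
  total-slices {suc m} {S} C _ | ‵inj₁ {i = t} _ = begin
    total S
      ≈⟨ total-last C ⟩
    ∑ xs (λ p → sliceFactor S L p * total (slice S L p))
      ≈⟨ ∑-cong xs (λ {p} _ → *-congˡ (total-slices (slice-MConvex C L p) t)) ⟩
    ∑ xs (λ p → sliceFactor S L p * ∑ xs (λ q → sliceFactor (slice S L p) t q * U p q))
      ≈⟨ ∑-cong xs (λ {p} _ → sym (∑-*ˡ (sliceFactor S L p) xs _)) ⟩
    ∑² (λ p q → sliceFactor S L p * (sliceFactor (slice S L p) t q * U p q))
      ≈⟨ ∑²-cong (λ p q → sym (*-assoc _ _ _)) ⟩
    ∑² (λ p q → row p q * U p q)
      ≈⟨ row-col ⟩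
    ∑² (λ p q → col p q * U p q)
      ≈⟨ ∑-swap xs xs (λ p q → col p q * U p q) ⟩
    ∑² (λ q p → col p q * U p q)
      ≈⟨ ∑²-cong (λ q p → trans (*-congˡ (total-cong (fiber-MConvex p q) (fiber-comm p q))) (*-assoc _ _ _)) ⟩
    ∑² (λ q p → sliceFactor S u′ q * (sliceFactor (slice S u′ q) (fromℕ m) p * total (slice (slice S u′ q) (fromℕ m) p)))
      ≈⟨ ∑-cong xs (λ {q} _ → ∑-*ˡ (sliceFactor S u′ q) xs _) ⟩
    ∑ xs (λ q → sliceFactor S u′ q * sliceSum (slice S u′ q) (fromℕ m))
      -- The last index is still last after t is removed, so the known case applies inside every
      -- slice by t.
      ≈⟨ ∑-cong xs (λ {q} _ → *-congˡ (total-last (slice-MConvex C u′ q))) ⟨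
    sliceSum S u′ ∎
    where open LastAndOther C t

-- Sums of a vector over subsets.

private
  +-interchange : ∀ a b c d → (a ℤ.+ b) ℤ.+ (c ℤ.+ d) ≡ (a ℤ.+ c) ℤ.+ (b ℤ.+ d)
  +-interchange = solve-∀

sumVec-cong : ∀ {n} {a b : Vect n} → a ≗ b → sumVec a ≡ sumVec b
sumVec-cong {zero} a≗b = ≡.refl
sumVec-cong {suc n} a≗b = cong₂ ℤ._+_ (a≗b zero) (sumVec-cong (a≗b ∘ suc))

sumOn-cong : ∀ {n} (I : Subset n) {a b} → a ≗ b → sumOn I a ≡ sumOn I b
sumOn-cong I a≗b = sumVec-cong (λ i → cong (if lookup I i then_else 0ℤ) (a≗b i))

sumVec-mono : ∀ {n} {a b : Vect n} → (∀ i → a i ≤ b i) → sumVec a ≤ sumVec b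
sumVec-mono {zero} a≤b = ℤₚ.≤-refl
sumVec-mono {suc n} a≤b = ℤₚ.+-mono-≤ (a≤b zero) (sumVec-mono (a≤b ∘ suc))

sumVec-mono-< : ∀ {n} {a b : Vect n} → (∀ i → a i ≤ b i) → ∀ i → a i < b i → sumVec a < sumVec b
sumVec-mono-< a≤b zero a<b = ℤₚ.+-mono-<-≤ a<b (sumVec-mono (a≤b ∘ suc))
sumVec-mono-< a≤b (suc i) a<b = ℤₚ.+-mono-≤-< (a≤b zero) (sumVec-mono-< (a≤b ∘ suc) i a<b)

sumOn-mono-< : ∀ {n} (I : Subset n) {a b} → (∀ k → lookup I k ≡ true → a k ≤ b k) →
  ∀ i → lookup I i ≡ true → a i < b i → sumOn I a < sumOn I b
sumOn-mono-< I {a} {b} a≤b i i∈I a<b = sumVec-mono-< mask≤ i mask<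
  where
  mask≤ : ∀ k → (if lookup I k then a k else 0ℤ) ≤ (if lookup I k then b k else 0ℤ)
  mask≤ k with lookup I k in k∈I
  ... | true = a≤b k k∈I
  ... | false = ℤₚ.≤-refl

  mask< : (if lookup I i then a i else 0ℤ) < (if lookup I i then b i else 0ℤ)
  mask< rewrite i∈I = a<b

-- Each term other than the i-th is bounded by g, and g i ≥ 0 fills the gap. Read as a lower bound
-- on a i, this gives the box containing the polymatroid.
sumVec≤+sumVec : ∀ {n} {a g : Vect n} → (∀ k → a k ≤ g k) → (∀ k → 0ℤ ≤ g k) → ∀ i →
  sumVec a ≤ a i ℤ.+ sumVec g
sumVec≤+sumVec {a = a} {g} a≤g 0≤g zero = ℤₚ.+-monoʳ-≤ (a zero)
  (ℤₚ.≤-trans (sumVec-mono (a≤g ∘ suc)) (subst (_≤ sumVec g) (ℤₚ.+-identityˡ _) (ℤₚ.+-monoˡ-≤ (sumVec (g ∘ suc)) (0≤g zero))))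
sumVec≤+sumVec {a = a} {g} a≤g 0≤g (suc i) = subst (sumVec a ≤_) (shuffle (g zero) (a (suc i)) _)
  (ℤₚ.+-mono-≤ (a≤g zero) (sumVec≤+sumVec (a≤g ∘ suc) (0≤g ∘ suc) i))
  where
  shuffle : ∀ p q r → p ℤ.+ (q ℤ.+ r) ≡ q ℤ.+ (p ℤ.+ r)
  shuffle = solve-∀

sumVec-nonneg : ∀ {n} {g : Vect n} → (∀ k → 0ℤ ≤ g k) → 0ℤ ≤ sumVec g
sumVec-nonneg {zero} 0≤g = ℤₚ.≤-refl
sumVec-nonneg {suc n} 0≤g = ℤₚ.+-mono-≤ (0≤g zero) (sumVec-nonneg (0≤g ∘ suc))

term≤sumVec : ∀ {n} {g : Vect n} → (∀ k → 0ℤ ≤ g k) → ∀ i → g i ≤ sumVec g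
term≤sumVec {g = g} 0≤g zero = subst (_≤ sumVec g) (ℤₚ.+-identityʳ _) (ℤₚ.+-monoʳ-≤ (g zero) (sumVec-nonneg (0≤g ∘ suc)))
term≤sumVec 0≤g (suc i) = subst (_≤ _) (ℤₚ.+-identityˡ _) (ℤₚ.+-mono-≤ (0≤g zero) (term≤sumVec (0≤g ∘ suc) i))

sumVec-pos : ∀ {n} (g : Fin n → ℕ) → sumVec (+_ ∘ g) ≡ + sumℕ g
sumVec-pos {zero} g = ≡.refl
sumVec-pos {suc n} g = cong (ℤ._+_ (+ g zero)) (sumVec-pos (g ∘ suc))

sumOn-⊥ : ∀ {n} (a : Vect n) → sumOn ⊥ a ≡ 0ℤ
sumOn-⊥ {zero} a = ≡.refl
sumOn-⊥ {suc n} a = ≡.trans (ℤₚ.+-identityˡ _) (sumOn-⊥ (a ∘ suc))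

sumOn-⊤ : ∀ {n} (a : Vect n) → sumOn ⊤ a ≡ sumVec a
sumOn-⊤ {zero} a = ≡.refl
sumOn-⊤ {suc n} a = cong (ℤ._+_ (a zero)) (sumOn-⊤ (a ∘ suc))

sumOn-⁅⁆ : ∀ {n} (t : Fin n) a → sumOn ⁅ t ⁆ a ≡ a t
sumOn-⁅⁆ zero a = ≡.trans (cong (ℤ._+_ (a zero)) (sumOn-⊥ (a ∘ suc))) (ℤₚ.+-identityʳ _)
sumOn-⁅⁆ (suc t) a = ≡.trans (ℤₚ.+-identityˡ _) (sumOn-⁅⁆ t (a ∘ suc))

sumOn-∁ : ∀ {n} (I : Subset n) a → sumOn I a ℤ.+ sumOn (∁ I) a ≡ sumVec a
sumOn-∁ [] a = ≡.refl
sumOn-∁ (true ∷ I) a = ≡.trans (+-interchange (a zero) _ 0ℤ _)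
  (cong₂ ℤ._+_ (ℤₚ.+-identityʳ (a zero)) (sumOn-∁ I (a ∘ suc)))
sumOn-∁ (false ∷ I) a = ≡.trans (+-interchange 0ℤ (sumOn I (a ∘ suc)) (a zero) (sumOn (∁ I) (a ∘ suc)))
  (cong₂ ℤ._+_ (ℤₚ.+-identityˡ (a zero)) (sumOn-∁ I (a ∘ suc)))

sumOn-modular : ∀ {n} (I J : Subset n) a → sumOn (I ∪ J) a ℤ.+ sumOn (I ∩ J) a ≡ sumOn I a ℤ.+ sumOn J a
sumOn-modular [] [] a = ≡.refl
sumOn-modular (p ∷ I) (q ∷ J) a = begin
  (s (p ∨ q) ℤ.+ sumOn (I ∪ J) a⁺) ℤ.+ (s (p ∧ q) ℤ.+ sumOn (I ∩ J) a⁺)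
    ≡⟨ +-interchange (s (p ∨ q)) _ (s (p ∧ q)) _ ⟩
  (s (p ∨ q) ℤ.+ s (p ∧ q)) ℤ.+ (sumOn (I ∪ J) a⁺ ℤ.+ sumOn (I ∩ J) a⁺)
    ≡⟨ cong₂ ℤ._+_ (head p q) (sumOn-modular I J a⁺) ⟩
  (s p ℤ.+ s q) ℤ.+ (sumOn I a⁺ ℤ.+ sumOn J a⁺)
    ≡⟨ +-interchange (s p) (s q) _ _ ⟩
  (s p ℤ.+ sumOn I a⁺) ℤ.+ (s q ℤ.+ sumOn J a⁺) ∎
  where
  open ≡.≡-Reasoning
  a⁺ = a ∘ suc

  s : Bool → ℤ
  s b = if b then a zero else 0ℤ

  head : ∀ p q → s (p ∨ q) ℤ.+ s (p ∧ q) ≡ s p ℤ.+ s q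
  head true q = ≡.refl
  head false q = ℤₚ.+-comm (s q) 0ℤ

sumOn-e : ∀ {n} (I : Subset n) i → sumOn I (e i) ≡ (if lookup I i then 1ℤ else 0ℤ)
sumOn-e (p ∷ I) zero = ≡.trans (cong (ℤ._+_ (s)) (≡.trans (sumOn-cong I (λ k → e-other {i = zero} {suc k} λ ())) (sumOn-0 I))) (ℤₚ.+-identityʳ s)
  where
  s = if p then 1ℤ else 0ℤ

  sumOn-0 : ∀ {n} (I : Subset n) → sumOn I (λ _ → 0ℤ) ≡ 0ℤ
  sumOn-0 [] = ≡.refl
  sumOn-0 (true ∷ I) = ≡.trans (ℤₚ.+-identityˡ _) (sumOn-0 I)
  sumOn-0 (false ∷ I) = ≡.trans (ℤₚ.+-identityˡ _) (sumOn-0 I)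
sumOn-e (p ∷ I) (suc i) = ≡.trans (cong₂ ℤ._+_ (head p) (≡.trans (sumOn-cong I (e-punchIn zero i)) (sumOn-e I i))) (ℤₚ.+-identityˡ _)
  where
  head : ∀ p → (if p then 0ℤ else 0ℤ) ≡ 0ℤ
  head true = ≡.refl
  head false = ≡.refl

sumOn-linear : ∀ {n} (I : Subset n) a b c →
  sumOn I (λ k → a k ℤ.- b k ℤ.+ c k) ≡ sumOn I a ℤ.- sumOn I b ℤ.+ sumOn I c
sumOn-linear [] a b c = ≡.refl
sumOn-linear (true ∷ I) a b c rewrite sumOn-linear I (a ∘ suc) (b ∘ suc) (c ∘ suc) =
  shuffle (a zero) (b zero) (c zero) _ _ _
  where
  shuffle : ∀ p q r x y z → p ℤ.- q ℤ.+ r ℤ.+ (x ℤ.- y ℤ.+ z) ≡ p ℤ.+ x ℤ.- (q ℤ.+ y) ℤ.+ (r ℤ.+ z)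
  shuffle = solve-∀
sumOn-linear (false ∷ I) a b c rewrite sumOn-linear I (a ∘ suc) (b ∘ suc) (c ∘ suc) =
  shuffle (sumOn I (a ∘ suc)) (sumOn I (b ∘ suc)) (sumOn I (c ∘ suc))
  where
  shuffle : ∀ x y z → 0ℤ ℤ.+ (x ℤ.- y ℤ.+ z) ≡ 0ℤ ℤ.+ x ℤ.- (0ℤ ℤ.+ y) ℤ.+ (0ℤ ℤ.+ z)
  shuffle = solve-∀

sumOn-moveOut : ∀ {n} (I : Subset n) a i j → sumOn I (moveOut a i j) ≡
  sumOn I a ℤ.- (if lookup I i then 1ℤ else 0ℤ) ℤ.+ (if lookup I j then 1ℤ else 0ℤ)
sumOn-moveOut I a i j = ≡.trans (sumOn-linear I a (e i) (e j))
  (cong₂ (λ p q → sumOn I a ℤ.- p ℤ.+ q) (sumOn-e I i) (sumOn-e I j))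

sumVec-moveOut : ∀ {n} (a : Vect n) i j → sumVec (moveOut a i j) ≡ sumVec a
sumVec-moveOut a i j = ≡.trans (≡.sym (sumOn-⊤ (moveOut a i j))) (≡.trans (sumOn-moveOut ⊤ a i j) total)
  where
  total : sumOn ⊤ a ℤ.- (if lookup ⊤ i then 1ℤ else 0ℤ) ℤ.+ (if lookup ⊤ j then 1ℤ else 0ℤ) ≡ sumVec a
  total rewrite Vecₚ.lookup-replicate i true | Vecₚ.lookup-replicate j true = ≡.trans (p-1+1 _) (sumOn-⊤ a)

lookup-ext : ∀ {n} {I J : Subset n} → (∀ i → lookup I i ≡ lookup J i) → I ≡ J
lookup-ext {I = I} {J} eq = ≡.trans (≡.sym (Vecₚ.tabulate∘lookup I)) (≡.trans (Vecₚ.tabulate-cong eq) (Vecₚ.tabulate∘lookup J))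

lookup-⁅⁆-self : ∀ {n} (t : Fin n) → lookup ⁅ t ⁆ t ≡ true
lookup-⁅⁆-self zero = ≡.refl
lookup-⁅⁆-self (suc t) = lookup-⁅⁆-self t

lookup-⁅⁆-other : ∀ {n} {t k : Fin n} → k ≢ t → lookup ⁅ t ⁆ k ≡ false
lookup-⁅⁆-other {t = zero} {zero} k≢t = contradiction ≡.refl k≢t
lookup-⁅⁆-other {t = zero} {suc k} k≢t = Vecₚ.lookup-replicate k false
lookup-⁅⁆-other {t = suc t} {zero} k≢t = ≡.refl
lookup-⁅⁆-other {t = suc t} {suc k} k≢t = lookup-⁅⁆-other (k≢t ∘ cong suc)

∈-allSubsets : ∀ {n} (I : Subset n) → I ∈ allSubsets n
∈-allSubsets [] = here ≡.refl
∈-allSubsets (true ∷ I) = ∈-concatMap⁺ _ (lose (∈-allSubsets I) (here ≡.refl))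
∈-allSubsets (false ∷ I) = ∈-concatMap⁺ _ (lose (∈-allSubsets I) (there (here ≡.refl)))

all-false : ∀ {A : Set} (p : A → Bool) xs → all p xs ≡ false → ∃ λ x → p x ≡ false
all-false p (x ∷ xs) eq with p x in px
... | false = x , px
... | true = all-false p xs eq

-- Polymatroids

module Polymatroid {n} (f : Subset n → ℤ) (f-⊥ : f ⊥ ≡ 0ℤ) (f-submodular : Submodular f) where

  P : Vect n → Bool
  P = inPolymatroid f

  record Base (a : Vect n) : Set where
    constructor base
    field
      sumOn≤f  : ∀ I → sumOn I a ≤ f I
      sumVec≡f : sumVec a ≡ f ⊤

  open Base

  ≤ᵇ-true : ∀ {i j} → i ≤ j → (i ℤ.≤ᵇ j) ≡ true
  ≤ᵇ-true i≤j = Equivalence.to T-≡ (ℤₚ.≤⇒≤ᵇ i≤j)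

  ⌊≟⌋-true : ∀ {i j} → i ≡ j → ⌊ i ℤₚ.≟ j ⌋ ≡ true
  ⌊≟⌋-true {i} {j} i≡j with i ℤₚ.≟ j
  ... | yes _ = ≡.refl
  ... | no i≢j = contradiction i≡j i≢j

  P⁺ : ∀ {a} → Base a → P a ≡ true
  P⁺ (base a≤f a≡f) = cong₂ _∧_ (all-true⁺ _ (allSubsets n) (λ {I} _ → ≤ᵇ-true (a≤f I))) (⌊≟⌋-true a≡f)

  P⁻ : ∀ {a} → P a ≡ true → Base a
  P⁻ {a} Pa with all (λ I → sumOn I a ℤ.≤ᵇ f I) (allSubsets n) in a≤f | sumVec a ℤₚ.≟ f ⊤
  ... | true | yes a≡f = base (λ I → ℤₚ.≤ᵇ⇒≤ (Equivalence.from T-≡ (all-true⁻ _ (allSubsets n) a≤f (∈-allSubsets I)))) a≡f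

  Base-resp : ∀ {a b} → a ≗ b → Base a → Base b
  Base-resp a≗b (base a≤f a≡f) =
    base (λ I → subst (_≤ f I) (sumOn-cong I a≗b) (a≤f I)) (≡.trans (≡.sym (sumVec-cong a≗b)) a≡f)

  P-resp : ∀ {a b} → a ≗ b → P a ≡ P b
  P-resp a≗b = iff⇒≡ (P⁺ ∘ Base-resp a≗b ∘ P⁻) (P⁺ ∘ Base-resp (≡.sym ∘ a≗b) ∘ P⁻)

  module _ {a : Vect n} (Ba : Base a) where

    Tight : Subset n → Set
    Tight I = sumOn I a ≡ f I

    -- The move raises the sum over I only if I contains j but not i, and then by exactly 1. As all
    -- values are integers, the bound f I can be exceeded only if a already attains it.
    blocked : ∀ {i j} → P (moveOut a i j) ≡ false → ∃ λ I → Tight I × lookup I i ≡ false × lookup I j ≡ true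
    blocked {i} {j} eq with all (λ I → sumOn I (moveOut a i j) ℤ.≤ᵇ f I) (allSubsets n) in a′≤f
                          | ⌊≟⌋-true (≡.trans (sumVec-moveOut a i j) (sumVec≡f Ba))
    ... | true | a′≡f = contradiction (≡.trans (≡.sym a′≡f) eq) λ ()
    ... | false | _ with all-false _ (allSubsets n) a′≤f
    ... | I , a′≰f = I , violated
      where
      a′≰ : ¬ (sumOn I (moveOut a i j) ≤ f I)
      a′≰ a′≤ = contradiction (≡.trans (≡.sym (≤ᵇ-true a′≤)) a′≰f) λ ()

      violated : Tight I × lookup I i ≡ false × lookup I j ≡ true
      violated with lookup I i | lookup I j | sumOn-moveOut I a i j
      ... | true  | true  | eq′ = contradiction (subst (_≤ f I) (≡.sym (≡.trans eq′ (p-1+1 _))) (sumOn≤f Ba I)) a′≰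
      ... | true  | false | eq′ = contradiction (subst (_≤ f I) (≡.sym (≡.trans eq′ (ℤₚ.+-identityʳ _)))
                                    (ℤₚ.≤-trans (ℤₚ.<⇒≤ (p-1<p _)) (sumOn≤f Ba I))) a′≰
      ... | false | false | eq′ = contradiction (subst (_≤ f I) (≡.sym (≡.trans eq′ (≡.trans (ℤₚ.+-identityʳ _) (ℤₚ.+-identityʳ _))))
                                    (sumOn≤f Ba I)) a′≰
      ... | false | true  | eq′ = ℤₚ.≤-antisym (sumOn≤f Ba I) (ℤₚ.≮⇒≥ λ a<f →
                                    a′≰ (subst (_≤ f I) (≡.sym (≡.trans eq′ (cong (ℤ._+ 1ℤ) (ℤₚ.+-identityʳ (sumOn I a))))) (<⇒+1≤ a<f))) ,
                                  ≡.refl , ≡.refl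

    -- By submodularity and tightness, f (I ∪ J) + f (I ∩ J) is at most the sum of a over I plus
    -- that over J, which equals the sum over I ∪ J plus that over I ∩ J. Each of these is at most
    -- its bound, so both bounds are attained.
    Tight-∪∩ : ∀ {I J} → Tight I → Tight J → Tight (I ∪ J) × Tight (I ∩ J)
    Tight-∪∩ {I} {J} tI tJ =
      squeeze (sumOn≤f Ba (I ∪ J)) (sumOn≤f Ba (I ∩ J))
        (ℤₚ.≤-trans (f-submodular I J) (ℤₚ.≤-reflexive (≡.trans (≡.sym (cong₂ ℤ._+_ tI tJ)) (≡.sym (sumOn-modular I J a)))))
      where
      squeeze : ∀ {p p′ q q′} → p ≤ p′ → q ≤ q′ → p′ ℤ.+ q′ ≤ p ℤ.+ q → p ≡ p′ × q ≡ q′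
      squeeze {p} {p′} {q} {q′} p≤ q≤ sum≤ =
        ℤₚ.≤-antisym p≤ (≤-shift (shuffle₁ p p′ q′) (ℤₚ.≤-trans sum≤ (ℤₚ.+-monoʳ-≤ p q≤))) ,
        ℤₚ.≤-antisym q≤ (≤-shift (shuffle₂ p′ q q′) (ℤₚ.≤-trans sum≤ (ℤₚ.+-monoˡ-≤ q p≤)))
        where
        shuffle₁ : ∀ p p′ q′ → p ℤ.- p′ ≡ p ℤ.+ q′ ℤ.- (p′ ℤ.+ q′)
        shuffle₁ = solve-∀

        shuffle₂ : ∀ p′ q q′ → q ℤ.- q′ ≡ p′ ℤ.+ q ℤ.- (p′ ℤ.+ q′)
        shuffle₂ = solve-∀

    -- U is the union of tight sets blocking the moves from i to the elements of B. It starts from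
    -- ⊥, which is tight because f ⊥ = 0.
    Tight-cover : ∀ {B : Fin n → Set} (B? : ∀ j → Dec (B j)) i → (∀ j → B j → P (moveOut a i j) ≡ false) →
      ∃ λ U → Tight U × lookup U i ≡ false × (∀ j → B j → lookup U j ≡ true)
    Tight-cover {B} B? i fixed with go (allFin n)
      where
      go : ∀ js → ∃ λ U → Tight U × lookup U i ≡ false × (∀ {j} → j ∈ js → B j → lookup U j ≡ true)
      go [] = ⊥ , ≡.trans (sumOn-⊥ a) (≡.sym f-⊥) , Vecₚ.lookup-replicate i false , λ ()
      go (j ∷ js) with go js | B? j
      ... | U , tU , i∉U , js⊆U | no ¬Bj =
            U , tU , i∉U , λ { (here ≡.refl) Bj → contradiction Bj ¬Bj ; (there k∈) → js⊆U k∈ }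
      ... | U , tU , i∉U , js⊆U | yes Bj with blocked (fixed j Bj)
      ... | I , tI , i∉I , j∈I = I ∪ U , proj₁ (Tight-∪∩ tI tU) ,
            ≡.trans (Vecₚ.lookup-zipWith _∨_ i I U) (cong₂ _∨_ i∉I i∉U) ,
            λ { (here ≡.refl) _ → ≡.trans (Vecₚ.lookup-zipWith _∨_ j I U) (cong (_∨ _) j∈I)
              ; {k} (there k∈) Bk → ≡.trans (Vecₚ.lookup-zipWith _∨_ k I U)
                                      (≡.trans (cong (lookup I k ∨_) (js⊆U k∈ Bk)) (Boolₚ.∨-zeroʳ _)) }
    ... | U , tU , i∉U , B⊆U = U , tU , i∉U , λ j → B⊆U (∈-allFin j)

    -- Dual to `Tight-cover`: the blocking sets now contain i and are intersected, starting from ⊤,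
    -- which is tight because a sums to f ⊤.
    Tight-avoid : ∀ {B : Fin n → Set} (B? : ∀ j → Dec (B j)) i → (∀ j → B j → P (moveOut a j i) ≡ false) →
      ∃ λ U → Tight U × lookup U i ≡ true × (∀ j → B j → lookup U j ≡ false)
    Tight-avoid {B} B? i fixed with go (allFin n)
      where
      go : ∀ js → ∃ λ U → Tight U × lookup U i ≡ true × (∀ {j} → j ∈ js → B j → lookup U j ≡ false)
      go [] = ⊤ , ≡.trans (sumOn-⊤ a) (sumVec≡f Ba) , Vecₚ.lookup-replicate i true , λ ()
      go (j ∷ js) with go js | B? j
      ... | U , tU , i∈U , js∉U | no ¬Bj =
            U , tU , i∈U , λ { (here ≡.refl) Bj → contradiction Bj ¬Bj ; (there k∈) → js∉U k∈ }
      ... | U , tU , i∈U , js∉U | yes Bj with blocked (fixed j Bj)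
      ... | I , tI , j∉I , i∈I = I ∩ U , proj₂ (Tight-∪∩ tI tU) ,
            ≡.trans (Vecₚ.lookup-zipWith _∧_ i I U) (cong₂ _∧_ i∈I i∈U) ,
            λ { (here ≡.refl) _ → ≡.trans (Vecₚ.lookup-zipWith _∧_ j I U) (cong (_∧ _) j∉I)
              ; {k} (there k∈) Bk → ≡.trans (Vecₚ.lookup-zipWith _∧_ k I U)
                                      (≡.trans (cong (lookup I k ∧_) (js∉U k∈ Bk)) (Boolₚ.∧-zeroʳ _)) }
    ... | U , tU , i∈U , B∉U = U , tU , i∈U , λ j → B∉U (∈-allFin j)

    move-into : ∀ {B : Fin n → Set} (B? : ∀ j → Dec (B j)) i →
      (∃ λ j → B j × P (moveOut a i j) ≡ true) ⊎
      (∃ λ U → Tight U × lookup U i ≡ false × (∀ j → B j → lookup U j ≡ true))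
    move-into B? i with Finₚ.any? (λ j → B? j ×-dec (P (moveOut a i j) Bool.≟ true))
    ... | yes found = inj₁ found
    ... | no none = inj₂ (Tight-cover B? i λ j Bj → ¬-not λ Pm → none (j , Bj , Pm))

    move-from : ∀ {B : Fin n → Set} (B? : ∀ j → Dec (B j)) i →
      (∃ λ j → B j × P (moveOut a j i) ≡ true) ⊎
      (∃ λ U → Tight U × lookup U i ≡ true × (∀ j → B j → lookup U j ≡ false))
    move-from B? i with Finₚ.any? (λ j → B? j ×-dec (P (moveOut a j i) Bool.≟ true))
    ... | yes found = inj₁ found
    ... | no none = inj₂ (Tight-avoid B? i λ j Bj → ¬-not λ Pm → none (j , Bj , Pm))

    -- Otherwise a tight U contains every j with a j < b j but not i. On U the sum of b is at most f
    -- U, the sum of a; outside U, b ≤ a with strict inequality at i. Then b would have a smaller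
    -- total than a.
    P-lower : ∀ {b} → Base b → ∀ i → b i < a i → ∃ λ j → a j < b j × P (moveOut a i j) ≡ true
    P-lower {b} Bb i b<a with move-into (λ j → a j ℤₚ.<? b j) i
    ... | inj₁ found = found
    ... | inj₂ (U , tU , i∉U , rising) = contradiction sum< (ℤₚ.<-irrefl (≡.trans (sumVec≡f Bb) (≡.sym (sumVec≡f Ba))))
      where
      outside⇒≤ : ∀ k → lookup (∁ U) k ≡ true → b k ≤ a k
      outside⇒≤ k k∉U = ℤₚ.≮⇒≥ λ a<b → contradiction
        (≡.trans (≡.sym k∉U) (≡.trans (Vecₚ.lookup-map k not U) (cong not (rising k a<b)))) λ ()

      sum< : sumVec b < sumVec a
      sum< = subst₂ _<_ (sumOn-∁ U b) (sumOn-∁ U a) (ℤₚ.+-mono-≤-<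
        (ℤₚ.≤-trans (sumOn≤f Bb U) (ℤₚ.≤-reflexive (≡.sym tU)))
        (sumOn-mono-< (∁ U) outside⇒≤ i (≡.trans (Vecₚ.lookup-map i not U) (cong not i∉U)) b<a))

    -- Otherwise a tight U contains i and no j with b j < a j. Then a ≤ b on U, strictly at i, so
    -- the sum of b over U exceeds f U.
    P-raise : ∀ {b} → Base b → ∀ i → a i < b i → ∃ λ j → b j < a j × P (moveOut a j i) ≡ true
    P-raise {b} Bb i a<b with move-from (λ j → b j ℤₚ.<? a j) i
    ... | inj₁ found = found
    ... | inj₂ (U , tU , i∈U , falling) = contradiction
      (ℤₚ.<-≤-trans (sumOn-mono-< U inside⇒≤ i i∈U a<b) (sumOn≤f Bb U))
      (ℤₚ.<-irrefl tU)
      where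
      inside⇒≤ : ∀ k → lookup U k ≡ true → a k ≤ b k
      inside⇒≤ k k∈U = ℤₚ.≮⇒≥ λ b<a → contradiction (≡.trans (≡.sym k∈U) (falling k b<a)) λ ()

    module _ (t : Fin n) where

      ≤βₜ : a t ≤ βₜ f t
      ≤βₜ = subst (_≤ βₜ f t) (sumOn-⁅⁆ t a) (sumOn≤f Ba ⁅ t ⁆)

      private
        a-t+∁ : a t ℤ.+ sumOn (∁ ⁅ t ⁆) a ≡ f ⊤
        a-t+∁ = ≡.trans (cong (ℤ._+ sumOn (∁ ⁅ t ⁆) a) (≡.sym (sumOn-⁅⁆ t a))) (≡.trans (sumOn-∁ ⁅ t ⁆ a) (sumVec≡f Ba))

      αₜ≤ : αₜ f t ≤ a t
      αₜ≤ = subst (λ s → s ℤ.- f (∁ ⁅ t ⁆) ≤ a t) a-t+∁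
        (≤-shift (shuffle (a t) (sumOn (∁ ⁅ t ⁆) a) (f (∁ ⁅ t ⁆))) (sumOn≤f Ba (∁ ⁅ t ⁆)))
        where
        shuffle : ∀ p q r → p ℤ.- (p ℤ.+ q ℤ.- r) ≡ r ℤ.- q
        shuffle = solve-∀

      -- If every move into t is blocked, the tight set that contains t and avoids all other indices
      -- is ⁅ t ⁆ itself, so a t = β. No second point with a larger coordinate is needed as a
      -- target. Dually, `lowerable` finds that the complement is tight.
      raisable : a t < βₜ f t → ∃ λ j → j ≢ t × P (moveOut a j t) ≡ true
      raisable a<β with move-from (λ j → ¬? (j Finₚ.≟ t)) t
      ... | inj₁ found = found
      ... | inj₂ (U , tU , t∈U , others∉U) = contradiction
        (≡.trans (≡.sym (sumOn-⁅⁆ t a)) (subst Tight (lookup-ext U≡⁅t⁆) tU)) (ℤₚ.<⇒≢ a<β)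
        where
        U≡⁅t⁆ : ∀ k → lookup U k ≡ lookup ⁅ t ⁆ k
        U≡⁅t⁆ k with k Finₚ.≟ t
        ... | yes ≡.refl = ≡.trans t∈U (≡.sym (lookup-⁅⁆-self t))
        ... | no k≢t = ≡.trans (others∉U k k≢t) (≡.sym (lookup-⁅⁆-other k≢t))

      lowerable : αₜ f t < a t → ∃ λ j → j ≢ t × P (moveOut a t j) ≡ true
      lowerable α<a with move-into (λ j → ¬? (j Finₚ.≟ t)) t
      ... | inj₁ found = found
      ... | inj₂ (U , tU , t∉U , others∈U) = contradiction α≡a (ℤₚ.<⇒≢ α<a)
        where
        U≡∁⁅t⁆ : ∀ k → lookup U k ≡ lookup (∁ ⁅ t ⁆) k
        U≡∁⁅t⁆ k with k Finₚ.≟ t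
        ... | yes ≡.refl = ≡.trans t∉U (≡.sym (≡.trans (Vecₚ.lookup-map t not ⁅ t ⁆) (cong not (lookup-⁅⁆-self t))))
        ... | no k≢t = ≡.trans (others∈U k k≢t) (≡.sym (≡.trans (Vecₚ.lookup-map k not ⁅ t ⁆) (cong not (lookup-⁅⁆-other k≢t))))

        α≡a : αₜ f t ≡ a t
        α≡a = ≡.trans (cong₂ ℤ._-_ (≡.sym a-t+∁) (≡.sym (subst Tight (lookup-ext U≡∁⁅t⁆) tU))) (cancel (a t) _)
          where
          cancel : ∀ p q → p ℤ.+ q ℤ.- q ≡ p
          cancel = solve-∀

  lowest : ℤ
  lowest = ℤ.- + bound f

  size : ℕ
  size = suc (2 ℕ.* bound f)

  P-boxed : ∀ {a} → Base a → ∀ i → a i ∈ range lowest size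
  P-boxed {a} Ba i = ∈-range lowest size low (ℤₚ.≤-<-trans high hi)
    where
    g : Vect n
    g k = + ∣ f ⁅ k ⁆ ∣

    G : ℕ
    G = sumℕ (λ k → ∣ f ⁅ k ⁆ ∣)

    i≤∣i∣ : ∀ i → i ≤ + ∣ i ∣
    i≤∣i∣ (+ _) = ℤₚ.≤-refl
    i≤∣i∣ ℤ.-[1+ _ ] = ℤ.-≤+

    -∣i∣≤i : ∀ i → ℤ.- + ∣ i ∣ ≤ i
    -∣i∣≤i i = ℤₚ.neg-cancel-≤ (subst₂ _≤_ ≡.refl (≡.trans (cong +_ (ℤₚ.∣-i∣≡∣i∣ i)) (≡.sym (ℤₚ.neg-involutive _))) (i≤∣i∣ (ℤ.- i)))

    0≤g : ∀ k → 0ℤ ≤ g k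
    0≤g k = ℤ.+≤+ ℕ.z≤n

    a≤g : ∀ k → a k ≤ g k
    a≤g k = ℤₚ.≤-trans (≤βₜ Ba k) (i≤∣i∣ _)

    high : a i ≤ + bound f
    high = ℤₚ.≤-trans (a≤g i) (ℤₚ.≤-trans (term≤sumVec 0≤g i)
      (subst (_≤ + bound f) (≡.sym (sumVec-pos (λ k → ∣ f ⁅ k ⁆ ∣))) (ℤ.+≤+ (ℕₚ.m≤n+m G ∣ f ⊤ ∣))))

    hi : + bound f < lowest ℤ.+ + size
    hi = +1≤⇒< (ℤₚ.≤-reflexive (≡.sym (shuffle (+ bound f))))
      where
      shuffle : ∀ B → ℤ.- B ℤ.+ (1ℤ ℤ.+ (B ℤ.+ (B ℤ.+ 0ℤ))) ≡ B ℤ.+ 1ℤ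
      shuffle = solve-∀

    low : lowest ≤ a i
    low = ≤-shift (≡.trans (cong (λ B → a i ℤ.- ℤ.- B) (ℤₚ.pos-+ ∣ f ⊤ ∣ G)) (shuffle (a i) (+ ∣ f ⊤ ∣) (+ G)))
      (ℤₚ.≤-trans (-∣i∣≤i (f ⊤)) (subst₂ _≤_ (sumVec≡f Ba) (cong (ℤ._+_ (a i)) (sumVec-pos (λ k → ∣ f ⁅ k ⁆ ∣))) (sumVec≤+sumVec a≤g 0≤g i)))
      where
      shuffle : ∀ p q r → p ℤ.- ℤ.- (q ℤ.+ r) ≡ p ℤ.+ r ℤ.- ℤ.- q
      shuffle = solve-∀

  xs≡range : map (λ k → + k ℤ.- + bound f) (upTo size) ≡ range lowest size
  xs≡range = map-upTo≡range _ lowest (λ k → ℤₚ.+-comm (+ k) lowest) size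

  P-MConvex : Convexity.MConvex (range lowest size) P
  P-MConvex = record
    { resp  = P-resp
    ; boxed = λ Pa → P-boxed (P⁻ Pa)
    ; lower = λ i Pa Pb → P-lower (P⁻ Pa) (P⁻ Pb) i
    ; raise = λ i Pa Pb → P-raise (P⁻ Pa) (P⁻ Pb) i
    }

-- The recursion for a polymatroid.

natPart-nonneg : ∀ {i} → 0ℤ ≤ i → + natPart i ≡ i
natPart-nonneg (ℤ.+≤+ _) = ≡.refl

module Recursion {c ℓ} (R : CommutativeRing c ℓ) (m : ℕ)
  (f : Subset (suc m) → ℤ) (f-⊥ : f ⊥ ≡ 0ℤ) (f-submodular : Submodular f)
  (t : Fin (suc m)) (gap : 0ℤ < βₜ f t ℤ.- αₜ f t) (x y : CommutativeRing.Carrier R) where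

  open CommutativeRing R hiding (zero)
  open Tutte R using (tutteP; sumList; weight)
  open TutteSlice R
  open Sums R
  open Polymatroid f f-⊥ f-submodular
  open ActivityWeight R x y
  open TutteRecursion R x y lowest size
  open Convexity xs
  open import Relation.Binary.Reasoning.Setoid setoid

  α β : ℤ
  α = αₜ f t
  β = βₜ f t

  G : ℤ → Carrier
  G p = total (slice P t p)

  -- Both sides of the theorem are brought to the form of a sum over p of a coefficient times `G p`;
  -- δ singles out one slice, and `D` below collects the inner ones.
  δ : ℤ → ℤ → Carrier
  δ p j = 1# when ⌊ p ℤₚ.≟ j ⌋

  box : List ℤ
  box = map (λ k → + k ℤ.- + bound f) (upTo size)

  ∑-box : ∀ F → ∑ (allVecs (suc m) box) F ≈ ∑ (allVecs (suc m) xs) F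
  ∑-box F = reflexive (cong (λ zs → ∑ (allVecs (suc m) zs) F) xs≡range)

  tutteP≈total : tutteP f x y ≈ total P
  tutteP≈total = trans (∑-filterᵇ P (allVecs (suc m) box) (weight P x y)) (∑-box (λ v → weight P x y v when P v))

  -- `sliceElems` lists the slice as projected elements of P with coordinate t equal to j. Written
  -- over the full box and split along coordinate t, the sum keeps only the part p = j.
  tutteSlice≈ : ∀ j → tutteSlice f t j x y ≈ ∑ xs (λ p → δ p j * G p)
  tutteSlice≈ j = begin
    tutteSlice f t j x y
      ≈⟨ ∑-map (_∘ punchIn t) (filterᵇ at-j (polymatroidElems f)) w ⟩
    ∑ (filterᵇ at-j (polymatroidElems f)) (w ∘ (_∘ punchIn t))
      ≈⟨ ∑-filterᵇ at-j (polymatroidElems f) _ ⟩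
    ∑ (polymatroidElems f) (λ a → w (a ∘ punchIn t) when at-j a)
      ≈⟨ ∑-filterᵇ P (allVecs (suc m) box) _ ⟩
    ∑ (allVecs (suc m) box) F
      ≈⟨ ∑-box F ⟩
    ∑ (allVecs (suc m) xs) F
      ≈⟨ ∑-insertAt xs t (λ {a} {b} a≗b → reflexive (cong₂ _when_
           (cong₂ _when_ (w-cong (a≗b ∘ punchIn t)) (cong (λ p → ⌊ p ℤₚ.≟ j ⌋) (a≗b t))) (P-resp a≗b))) ⟩
    ∑ xs (λ p → ∑ (allVecs m xs) (λ v → F (insertAt t p v)))
      ≈⟨ ∑-cong xs (λ {p} _ → trans (∑-cong (allVecs m xs) λ {v} _ → F-insertAt p v) (∑-*ˡ (δ p j) (allVecs m xs) _)) ⟩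
    ∑ xs (λ p → δ p j * G p) ∎
    where
    at-j : Vect (suc m) → Bool
    at-j a = ⌊ a t ℤₚ.≟ j ⌋

    w : Vect m → Carrier
    w = weight (slice P t j) x y

    w-cong : ∀ {v v′} → v ≗ v′ → w v ≡ w v′
    w-cong = weight-cong {S = slice P t j} (resp (slice-MConvex P-MConvex t j))

    F : Vect (suc m) → Carrier
    F a = w (a ∘ punchIn t) when at-j a when P a

    F-insertAt : ∀ p v → F (insertAt t p v) ≈ δ p j * (weight (slice P t p) x y v when slice P t p v)
    F-insertAt p v rewrite insertAt-hit t p v with p ℤₚ.≟ j
    ... | yes ≡.refl = trans (reflexive (cong (_when P (insertAt t p v)) (w-cong (insertAt-miss t p v)))) (sym (*-identityˡ _))
    ... | no _ = trans (0-when (P (insertAt t p v))) (sym (zeroˡ _))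
      where
      0-when : ∀ b → 0# when b ≈ 0#
      0-when true = refl
      0-when false = refl

  innerSize : ℕ
  innerSize = natPart (β ℤ.- 1ℤ ℤ.- (α ℤ.+ 1ℤ) ℤ.+ 1ℤ)

  inner : List ℤ
  inner = range (α ℤ.+ 1ℤ) innerSize

  D : ℤ → Carrier
  D p = ∑ inner (δ p)

  ∑-*ʳ : ∀ {A : Set} (zs : List A) F k → ∑ zs (λ a → F a * k) ≈ ∑ zs F * k
  ∑-*ʳ zs F k = trans (∑-cong zs λ _ → *-comm _ k) (trans (∑-*ˡ k zs F) (*-comm k _))

  inner-sum : sumList (map (λ j → tutteSlice f t j x y) (intervalℤ (α ℤ.+ 1ℤ) (β ℤ.- 1ℤ))) ≈ ∑ xs (λ p → D p * G p)
  inner-sum = begin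
    sumList (map (λ j → tutteSlice f t j x y) (intervalℤ (α ℤ.+ 1ℤ) (β ℤ.- 1ℤ)))
      ≈⟨ sumList-map (intervalℤ (α ℤ.+ 1ℤ) (β ℤ.- 1ℤ)) ⟩
    ∑ (intervalℤ (α ℤ.+ 1ℤ) (β ℤ.- 1ℤ)) (λ j → tutteSlice f t j x y)
      ≈⟨ reflexive (cong (λ zs → ∑ zs (λ j → tutteSlice f t j x y)) (map-upTo≡range _ (α ℤ.+ 1ℤ) (λ _ → ≡.refl) innerSize)) ⟩
    ∑ inner (λ j → tutteSlice f t j x y)
      ≈⟨ ∑-cong inner (λ {j} _ → tutteSlice≈ j) ⟩
    ∑ inner (λ j → ∑ xs (λ p → δ p j * G p))
      ≈⟨ ∑-swap inner xs (λ j p → δ p j * G p) ⟩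
    ∑ xs (λ p → ∑ inner (λ j → δ p j * G p))
      ≈⟨ ∑-cong xs (λ {p} _ → ∑-*ʳ inner (δ p) (G p)) ⟩
    ∑ xs (λ p → D p * G p) ∎
    where
    sumList-map : ∀ {g : ℤ → Carrier} zs → sumList (map g zs) ≈ ∑ zs g
    sumList-map [] = refl
    sumList-map (j ∷ zs) = +-congˡ (sumList-map zs)

  module _ {p} (occ : occupied P t p ≡ true) where

    private
      point : ∃ λ a → P a ≡ true × a t ≡ p
      point = occupied⁻ P-MConvex {t} occ

      a : Vect (suc m)
      a = proj₁ point

      Ba : Base a
      Ba = P⁻ (proj₁ (proj₂ point))

      at : a t ≡ p
      at = proj₂ (proj₂ point)

    α≤ : α ≤ p
    α≤ = subst (α ≤_) at (αₜ≤ Ba t)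

    ≤β : p ≤ β
    ≤β = subst (_≤ β) at (≤βₜ Ba t)

    occupied-below : α < p → occupied P t (p ℤ.- 1ℤ) ≡ true
    occupied-below α<p with lowerable Ba t (subst (α <_) (≡.sym at) α<p)
    ... | j , j≢t , Pm = occupied⁺ P-MConvex {t} {a = moveOut a t j} Pm
      (≡.trans (moveOut-source a (j≢t ∘ ≡.sym)) (cong (ℤ._- 1ℤ) at))

    occupied-above : p < β → occupied P t (p ℤ.+ 1ℤ) ≡ true
    occupied-above p<β with raisable Ba t (subst (_< β) (≡.sym at) p<β)
    ... | j , j≢t , Pm = occupied⁺ P-MConvex {t} {a = moveOut a j t} Pm
      (≡.trans (moveOut-target a j≢t) (cong (ℤ._+ 1ℤ) at))

  α<β : α < β
  α<β = subst₂ _<_ (ℤₚ.+-identityˡ α) (cancel β α) (ℤₚ.+-monoˡ-< α gap)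
    where
    cancel : ∀ p q → p ℤ.- q ℤ.+ q ≡ p
    cancel = solve-∀

  unoccupied-α-1 : occupied P t (α ℤ.- 1ℤ) ≡ false
  unoccupied-α-1 = ¬-not λ occ → ℤₚ.≤⇒≯ (α≤ occ) (p-1<p α)

  unoccupied-β+1 : occupied P t (β ℤ.+ 1ℤ) ≡ false
  unoccupied-β+1 = ¬-not λ occ → ℤₚ.≤⇒≯ (≤β occ) (p<p+1 β)

  -- The inner interval has β - α - 1 elements; this is nonnegative since α < β, so `natPart`
  -- truncates nothing.
  inner-end : α ℤ.+ 1ℤ ℤ.+ + innerSize ≡ β
  inner-end = ≡.trans (cong (ℤ._+_ (α ℤ.+ 1ℤ)) (natPart-nonneg (≤-shift (shift α β) (<⇒+1≤ α<β)))) (cancel α β)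
    where
    shift : ∀ α β → β ℤ.- 1ℤ ℤ.- (α ℤ.+ 1ℤ) ℤ.+ 1ℤ ℤ.- 0ℤ ≡ β ℤ.- (α ℤ.+ 1ℤ)
    shift = solve-∀

    cancel : ∀ α β → α ℤ.+ 1ℤ ℤ.+ (β ℤ.- 1ℤ ℤ.- (α ℤ.+ 1ℤ) ℤ.+ 1ℤ) ≡ β
    cancel = solve-∀

  -- An occupied p lies between α and β. At α only the value below is vacant, at β only the value
  -- above, and strictly between neither; α < β excludes the factor x + y - 1.
  factor : ∀ p → occupied P t p ≡ true → sliceFactor P t p ≈ x * δ p α + y * δ p β + D p
  factor p occ with p ℤₚ.≟ α | p ℤₚ.≟ β
  ... | yes ≡.refl | yes α≡β = contradiction α≡β (ℤₚ.<⇒≢ α<β)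
  ... | yes ≡.refl | no _ = begin
    sliceFactor P t α          ≈⟨ reflexive (cong₂ (λ b c → activity (not b) (not c)) unoccupied-α-1 (occupied-above occ α<β)) ⟩
    x                          ≈⟨ trans (+-identityʳ _) (trans (+-identityʳ _) (*-identityʳ x)) ⟨
    x * 1# + 0# + 0#           ≈⟨ +-cong (+-congˡ (zeroʳ y)) (∑-range-δ-outside (α ℤ.+ 1ℤ) innerSize α α∉) ⟨
    x * 1# + y * 0# + D α      ∎
    where
    α∉ : ¬ (α ∈ inner)
    α∉ α∈ = ℤₚ.≤⇒≯ (∈-range⇒≥ (α ℤ.+ 1ℤ) innerSize α∈) (p<p+1 α)
  ... | no _ | yes ≡.refl = begin
    sliceFactor P t β          ≈⟨ reflexive (cong₂ (λ b c → activity (not b) (not c)) (occupied-below occ α<β) unoccupied-β+1) ⟩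
    y                          ≈⟨ trans (+-identityʳ _) (trans (+-identityˡ _) (*-identityʳ y)) ⟨
    0# + y * 1# + 0#           ≈⟨ +-cong (+-congʳ (zeroʳ x)) (∑-range-δ-outside (α ℤ.+ 1ℤ) innerSize β β∉) ⟨
    x * 0# + y * 1# + D β      ∎
    where
    β∉ : ¬ (β ∈ inner)
    β∉ β∈ = ℤₚ.<-irrefl (≡.sym inner-end) (∈-range⇒< (α ℤ.+ 1ℤ) innerSize β∈)
  ... | no p≢α | no p≢β = begin
    sliceFactor P t p          ≈⟨ reflexive (cong₂ (λ b c → activity (not b) (not c)) (occupied-below occ α<p) (occupied-above occ p<β)) ⟩
    1#                         ≈⟨ trans (+-congʳ (+-identityʳ 0#)) (+-identityˡ 1#) ⟨
    0# + 0# + 1#               ≈⟨ +-cong (+-cong (zeroʳ x) (zeroʳ y)) (∑-range-δ-inside (α ℤ.+ 1ℤ) innerSize p p∈) ⟨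
    x * 0# + y * 0# + D p      ∎
    where
    α<p : α < p
    α<p = ℤₚ.≤∧≢⇒< (α≤ occ) (p≢α ∘ ≡.sym)

    p<β : p < β
    p<β = ℤₚ.≤∧≢⇒< (≤β occ) p≢β

    p∈ : p ∈ inner
    p∈ = ∈-range (α ℤ.+ 1ℤ) innerSize (<⇒+1≤ α<p) (subst (p <_) (≡.sym inner-end) p<β)

  theorem : tutteP f x y ≈ x * tutteSlice f t α x y + y * tutteSlice f t β x y
              + sumList (map (λ j → tutteSlice f t j x y) (intervalℤ (α ℤ.+ 1ℤ) (β ℤ.- 1ℤ)))
  theorem = begin
    tutteP f x y
      ≈⟨ tutteP≈total ⟩
    total P
      ≈⟨ total-slices P-MConvex t ⟩
    ∑ xs (λ p → sliceFactor P t p * G p)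
      ≈⟨ ∑-cong xs (λ {p} _ → local p) ⟩
    ∑ xs (λ p → x * (δ p α * G p) + y * (δ p β * G p) + D p * G p)
      ≈⟨ trans (∑-+ xs _ _) (+-congʳ (∑-+ xs _ _)) ⟩
    ∑ xs (λ p → x * (δ p α * G p)) + ∑ xs (λ p → y * (δ p β * G p)) + ∑ xs (λ p → D p * G p)
      ≈⟨ +-cong (+-cong (scaled x α) (scaled y β)) (sym inner-sum) ⟩
    x * tutteSlice f t α x y + y * tutteSlice f t β x y
      + sumList (map (λ j → tutteSlice f t j x y) (intervalℤ (α ℤ.+ 1ℤ) (β ℤ.- 1ℤ))) ∎
    where
    scaled : ∀ k j → ∑ xs (λ p → k * (δ p j * G p)) ≈ k * tutteSlice f t j x y
    scaled k j = trans (∑-*ˡ k xs _) (*-congˡ (sym (tutteSlice≈ j)))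

    local : ∀ p → sliceFactor P t p * G p ≈ x * (δ p α * G p) + y * (δ p β * G p) + D p * G p
    local p = trans weighted (trans (distribʳ _ _ _) (+-congʳ (trans (distribʳ _ _ _) (+-cong (*-assoc _ _ _) (*-assoc _ _ _)))))
      where
      weighted : sliceFactor P t p * G p ≈ (x * δ p α + y * δ p β + D p) * G p
      weighted with occupied P t p in occ
      ... | true = *-congʳ (factor p occ)
      -- For a value p not taken on P the coefficients need not agree, but the slice is empty and
      -- `G p` vanishes.
      ... | false = trans (trans (*-congˡ empty) (zeroʳ _)) (sym (trans (*-congˡ empty) (zeroʳ _)))
        where
        empty : G p ≈ 0#
        empty = total-empty (¬inhabited⇒¬∃ (slice-MConvex P-MConvex t p) occ)

theorem3p5 : ∀ {c ℓ} (R : CommutativeRing c ℓ) (m : ℕ)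
  (f : Subset (suc m) → ℤ) → f ⊥ ≡ 0ℤ → Submodular f →
  (t : Fin (suc m)) → 0ℤ < βₜ f t ℤ.- αₜ f t →
  (x y : CommutativeRing.Carrier R) →
  let open CommutativeRing R
      open Tutte R
      open TutteSlice R
  in tutteP f x y
     ≈ x * tutteSlice f t (αₜ f t) x y
       + y * tutteSlice f t (βₜ f t) x y
       + sumList (map (λ j → tutteSlice f t j x y)
                      (intervalℤ (αₜ f t ℤ.+ 1ℤ) (βₜ f t ℤ.- 1ℤ)))
theorem3p5 = Recursion.theorem
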